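{- Let $q=p^k$ be an odd prime power. Let $X$ be a cubic arc-transitive graph of type $\{1,2^1\}$ whose full automorphism group is $G^*=\mathrm{PGL}(2,q)$, such that $G=\mathrm{PSL}(2,q)\le G^*$ is a $1$-arc-regular subgroup of automorphisms. If $p\equiv 0,\pm 1\pmod 5$, then the intersection density of $G^*$ acting on the vertex set of $X$ is $\rho(G^*)=1$.
   Context: For a transitive permutation group $H\le \mathrm{Sym}(V)$, a subset $\mathcal F\subseteq H$ is intersecting if any two $f,g\in\mathcal F$ satisfy $f(v)=g(v)$ for some $v\in V$; the intersection density is $\rho(H)=\max\{|\mathcal F|:\mathcal F\subseteq H\text{ intersecting}\}/(|H|/|V|)$. An $s$-arc is a sequence $(u_0,\dots,u_s)$ of distinct vertices with consecutive ones adjacent; a group is $s$-arc-regular if it acts regularly on $s$-arcs. A cubic arc-transitive graph $X$ is of type $\{1,2^1\}$ if its full automorphism group acts regularly on $2$-arcs, it has a subgroup acting regularly on arcs, and the edge stabilizer in $\mathrm{Aut}(X)$ is isomorphic to $\mathbb{Z}_2^2$. -}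

module Defs where

open import Level using (0ℓ)
open import Data.Nat using (ℕ; suc; _+_; _*_; _^_; _≤_; _%_)
open import Data.Nat.Primality using (Prime)
open import Data.Fin using (Fin)
open import Data.Bool using (Bool; _xor_)
open import Data.Product using (Σ; ∃; ∃-syntax; _×_; _,_)
open import Data.Sum using (_⊎_)
open import Data.List using (List; length)
open import Data.List.Relation.Unary.All using (All)
open import Data.List.Relation.Unary.Any using (Any)
open import Data.List.Relation.Unary.AllPairs using (AllPairs)
open import Relation.Nullary using (¬_)
open import Relation.Binary.PropositionalEquality using (_≡_; _≢_; _≗_)
open import Function using (_∘_; id)
open import Function.Definitions using (Injective)
open import Algebra.Structures using (IsCommutativeRing)

-- Finite fields: a field structure on the carrier Fin q
-- (every finite field of order q is isomorphic to one of these).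

record FiniteField (q : ℕ) : Set where
  field
    _+F_ _*F_ : Fin q → Fin q → Fin q
    -F_       : Fin q → Fin q
    0F 1F     : Fin q
    isCommutativeRing : IsCommutativeRing _≡_ _+F_ _*F_ -F_ 0F 1F
    0≢1       : 0F ≢ 1F
    inverse   : ∀ x → x ≢ 0F → ∃[ y ] (x *F y ≡ 1F)

record M2 (q : ℕ) : Set where
  constructor mat
  field a b c d : Fin q

module _ {q : ℕ} (F : FiniteField q) where
  open FiniteField F

  _·M_ : M2 q → M2 q → M2 q
  mat a b c d ·M mat a' b' c' d' =
    mat ((a *F a') +F (b *F c')) ((a *F b') +F (b *F d'))
        ((c *F a') +F (d *F c')) ((c *F b') +F (d *F d'))

  det : M2 q → Fin q
  det (mat a b c d) = (a *F d) +F (-F (b *F c))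

  InGL : M2 q → Set
  InGL A = det A ≢ 0F

  InSL : M2 q → Set
  InSL A = det A ≡ 1F

  -- nonzero scalar matrices λI, λ ≠ 0: the kernel of GL(2,F) → PGL(2,F)
  Scalar : M2 q → Set
  Scalar (mat a b c d) = (b ≡ 0F) × (c ≡ 0F) × (a ≡ d) × (a ≢ 0F)

record Graph (n : ℕ) : Set₁ where
  field
    Adj   : Fin n → Fin n → Set
    sym   : ∀ {u v} → Adj u v → Adj v u
    irref : ∀ {u} → ¬ Adj u u

module _ {n : ℕ} (X : Graph n) where
  open Graph X

  Cubic : Set
  Cubic = ∀ v → ∃[ x ] ∃[ y ] ∃[ z ]
    (Adj v x × Adj v y × Adj v z × x ≢ y × x ≢ z × y ≢ z ×
     (∀ w → Adj v w → (w ≡ x) ⊎ (w ≡ y) ⊎ (w ≡ z)))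

  data Walk : Fin n → Fin n → Set where
    here : ∀ {u} → Walk u u
    step : ∀ {u v w} → Adj u v → Walk v w → Walk u w

  Connected : Set
  Connected = ∀ u v → Walk u v

  -- automorphisms: permutations of Fin n (injective self-maps of a
  -- finite set) preserving adjacency and non-adjacency
  IsAut : (Fin n → Fin n) → Set
  IsAut f = Injective _≡_ _≡_ f × (∀ u v → (Adj u v → Adj (f u) (f v)) × (Adj (f u) (f v) → Adj u v))

  Arc : Set
  Arc = Σ (Fin n × Fin n) λ { (u , v) → Adj u v }

  TwoArc : Set
  TwoArc = Σ (Fin n × Fin n × Fin n) λ { (u , v , w) → Adj u v × Adj v w × u ≢ w }

  MapsArc : (Fin n → Fin n) → Arc → Arc → Set
  MapsArc f ((u , v) , _) ((u' , v') , _) = (f u ≡ u') × (f v ≡ v')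

  MapsTwoArc : (Fin n → Fin n) → TwoArc → TwoArc → Set
  MapsTwoArc f ((u , v , w) , _) ((u' , v' , w') , _) = (f u ≡ u') × (f v ≡ v') × (f w ≡ w')

  RegularOnArcs : ((Fin n → Fin n) → Set) → Set
  RegularOnArcs H = ∀ α β →
    (∃[ h ] (H h × MapsArc h α β)) ×
    (∀ h h' → H h → H h' → MapsArc h α β → MapsArc h' α β → h ≗ h')

  RegularOnTwoArcs : ((Fin n → Fin n) → Set) → Set
  RegularOnTwoArcs H = ∀ α β →
    (∃[ h ] (H h × MapsTwoArc h α β)) ×
    (∀ h h' → H h → H h' → MapsTwoArc h α β → MapsTwoArc h' α β → h ≗ h')

  ArcTransitive : Set
  ArcTransitive = ∀ α β → ∃[ h ] (IsAut h × MapsArc h α β)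

  IsSubgroupOfAut : ((Fin n → Fin n) → Set) → Set
  IsSubgroupOfAut H =
    (∀ h → H h → IsAut h) × H id ×
    (∀ g h → H g → H h → H (g ∘ h)) ×
    (∀ h → H h → ∃[ h' ] (H h' × (h ∘ h') ≗ id))

  StabEdge : Fin n → Fin n → (Fin n → Fin n) → Set
  StabEdge u v f = IsAut f × (((f u ≡ u) × (f v ≡ v)) ⊎ ((f u ≡ v) × (f v ≡ u)))

  StabEdgeIsZ2² : Set
  StabEdgeIsZ2² = ∀ u v → Adj u v → Σ (Bool × Bool → Fin n → Fin n) λ φ →
    ((∀ x → StabEdge u v (φ x)) ×
     (∀ x y → φ (Data.Product.zip _xor_ _xor_ x y) ≗ (φ x ∘ φ y)) ×
     (∀ x y → φ x ≗ φ y → x ≡ y) ×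
     (∀ f → StabEdge u v f → ∃[ x ] (f ≗ φ x)))

  TypeOne2¹ : Set₁
  TypeOne2¹ = RegularOnTwoArcs IsAut ×
              (∃[ H ] (IsSubgroupOfAut H × RegularOnArcs H)) ×
              StabEdgeIsZ2²

module _ {n : ℕ} where

  Distinct : List (Fin n → Fin n) → Set
  Distinct = AllPairs (λ f g → ¬ (f ≗ g))

  Enumerates : ((Fin n → Fin n) → Set) → List (Fin n → Fin n) → Set
  Enumerates H L = All H L × Distinct L × (∀ f → H f → Any (f ≗_) L)

  IntersectingFamily : ((Fin n → Fin n) → Set) → List (Fin n → Fin n) → Set
  IntersectingFamily H L = All H L × Distinct L × AllPairs (λ f g → ∃[ v ] (f v ≡ g v)) L

  -- ρ(H) = 1 on Fin n, i.e. max{|F| : F ⊆ H intersecting} = |H| / n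
  IntersectionDensityOne : ((Fin n → Fin n) → Set) → Set
  IntersectionDensityOne H = ∀ L → Enumerates H L →
    (∃[ F ] (IntersectingFamily H F × length F * n ≡ length L)) ×
    (∀ F → IntersectingFamily H F → length F * n ≤ length L)

{-# OPTIONS --safe #-}

-- The form ⟪ A , B ⟫ = tr (adj A · B) on the 4-dimensional space of 2×2 matrices is bilinear and
-- ⟪ A , A ⟫ = 2 det A.  An automorphism fixing a vertex permutes its three neighbours either as a
-- reflection, and is then an involution outside PSL(2,q) (trace 0), or as a rotation, and is then
-- an element of PSL(2,q) of order dividing 3 (trace² = det).  An intersecting family therefore
-- yields matrices Aᵢ of determinant 1 and Bⱼ of a fixed nonsquare determinant ε such that
-- ⟪ Aᵢ , Aⱼ ⟫ = ±1 and ⟪ Bᵢ , Bⱼ ⟫ = ±ε for i ≠ j, while ⟪ Aᵢ , Bⱼ ⟫ = 0.  Any five of these matrices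
-- are linearly dependent, so the integral 5×5 Gram matrix read off from the signs is singular over
-- F_q.  When the characteristic is not 2 or 3, running through the possible signs leaves at most
-- six matrices.  The congruence on p only serves to exclude p = 3.

module Submission where

open import Defs
open import Level using (0ℓ)
open import Data.Bool using (Bool; true; false; _∨_; if_then_else_; T)
open import Data.Bool.ListAction using (any; all)
import Data.Bool.Properties as Bool
open import Data.Empty using (⊥; ⊥-elim)
open import Data.Fin as Fin using (Fin; zero; suc; funToFin; finToFun; punchIn; punchOut; combine; remQuot)
import Data.Fin.Permutation as Perm
import Data.Fin.Properties as Fin
open import Data.Integer as ℤ using (ℤ; -[1+_]; _⊖_; 0ℤ; 1ℤ; -1ℤ) renaming (+_ to pos)
import Data.Integer.DivMod as ℤ
import Data.Integer.Properties as ℤ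
open import Data.List as List using (List; []; _∷_; _++_; length; replicate; take; cartesianProductWith)
import Data.List.Properties as List
open import Data.List.Membership.Propositional using (_∈_)
open import Data.List.Membership.Propositional.Properties using (∈-cartesianProductWith⁺; ∈-lookup)
open import Data.List.Relation.Unary.All as All using (All; []; _∷_)
import Data.List.Relation.Unary.All.Properties as All
open import Data.List.Relation.Unary.AllPairs as AllPairs using (AllPairs; []; _∷_)
import Data.List.Relation.Unary.AllPairs.Properties as AllPairs
open import Data.List.Relation.Unary.Any as Any using (Any; here; there)
import Data.List.Relation.Unary.Any.Properties as Any
open import Data.Maybe using (just; nothing)
open import Data.Nat as ℕ using (ℕ; zero; suc; _^_; _≤_; _<_; _%_; z≤n; s≤s)
open import Data.Nat.Coprimality using (coprime-Bézout)
open import Data.Nat.Divisibility using (_∣_; ∣1⇒≡1)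
open import Data.Nat.GCD using (module Bézout)
open import Data.Nat.Primality using (Prime; euclidsLemma; prime?; prime⇒irreducible; prime[2]; ¬prime[1])
import Data.Nat.Properties as ℕ
open import Data.Product using (_×_; ∃-syntax; _,_; proj₁; proj₂)
open import Data.Sum using (_⊎_; inj₁; inj₂; [_,_])
open import Data.Vec as Vec using (Vec; []; _∷_; lookup; tabulate)
import Data.Vec.Properties as Vec
open import Algebra.Bundles using (CommutativeRing)
import Algebra.Properties.AbelianGroup as AbelianGroupProperties
import Algebra.Properties.Group as GroupProperties
import Algebra.Properties.Ring as RingProperties
import Algebra.Properties.Semiring.Mult as SemiringMult
import Algebra.Properties.Semiring.Sum as SemiringSum
import Algebra.Solver.Ring as RingSolver
open import Algebra.Solver.Ring.AlmostCommutativeRing using (fromCommutativeRing; _-Raw-AlmostCommutative⟶_)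
open import Function using (_∘_; id)
open import Function.Bundles using (Equivalence)
open import Function.Definitions using (Injective)
open import Relation.Binary.Definitions using (WeaklyDecidable)
open import Relation.Binary.PropositionalEquality using (_≡_; _≢_; _≗_; refl; sym; trans; cong; cong₂; subst; subst₂; module ≡-Reasoning)
open import Relation.Nullary using (¬_; Dec; yes; no; does; isYes; contradiction)
open import Relation.Nullary.Decidable using (toWitness; map′; from-yes; ¬?; _×-dec_; _⊎-dec_; _→-dec_)

-- The obstacle is to treat all fields at once, although ε is not an integer. Dividing each column
-- of a Gram matrix by the determinant of the matrix it belongs to leaves only the integers 2, 1, -1
-- and 0, so one finite search over ℤ serves every q. A 5×5 pattern G counts as nonsingular only if
-- an integral C with G C = 324 I is found: this identity survives in F_q, where 324 = 2² · 3⁴ is a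
-- unit. It is the least common multiple of 162 (up to sign the determinant for five matrices of one
-- type with all signs negative) and 12 (three of one type with all signs positive and two of the
-- other). Patterns whose determinant is divisible by 5 do occur, but 5 is a possible
-- characteristic, so the search must find other submatrices. Six is the order of a vertex
-- stabilizer. It has three elements in PSL(2,q) and three outside, so the split 3 + 3 has to
-- survive, while 4 + 2 and 5 + 1 are already impossible.

module FieldFacts {q : ℕ} (F : FiniteField q) where

  -- Field arithmetic and the reduction of integers.

  commutativeRing : CommutativeRing 0ℓ 0ℓ
  commutativeRing = record { isCommutativeRing = FiniteField.isCommutativeRing F }

  open FiniteField F public using (inverse; 0≢1)
  open CommutativeRing commutativeRing public
    hiding (refl; sym; trans; zero; isCommutativeRing; _≈_)
  open RingProperties ring using (-‿distribˡ-*; -‿distribʳ-*; -0#≈0#)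
  open AbelianGroupProperties +-abelianGroup using (⁻¹-∙-comm)
  open GroupProperties +-group using (⁻¹-involutive; ∙-cancelˡ)
  open SemiringMult semiring using (×-homo-+; ×1-homo-*) renaming (_×_ to _·_)
  open SemiringSum semiring public using (sum; ∑-distrib-+; ∑-comm; sum-permute; sum-cong-≗; *-distribˡ-sum; *-distribʳ-sum; sum-replicate)
  open ≡-Reasoning

  -- Serves twice: as the coefficient map of the ring solver, and to reduce integral Gram matrices
  -- to the field.
  ι : ℤ → Fin q
  ι (pos n)    = n · 1#
  ι -[1+ n ] = - (suc n · 1#)

  ι-neg : ∀ i → ι (ℤ.- i) ≡ - ι i
  ι-neg (pos zero)  = sym -0#≈0#
  ι-neg (pos (suc n)) = refl
  ι-neg -[1+ n ]  = sym (⁻¹-involutive _)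

  private
    cancel-1 : ∀ x y → x + - y ≡ (1# + x) + - (1# + y)
    cancel-1 x y = begin
      x + - y                          ≡⟨ cong (x +_) (+-identityˡ _) ⟨
      x + (0# + - y)                   ≡⟨ cong (λ z → x + (z + - y)) (-‿inverseʳ 1#) ⟨
      x + ((1# + - 1#) + - y)          ≡⟨ cong (x +_) (+-assoc _ _ _) ⟩
      x + (1# + (- 1# + - y))          ≡⟨ +-assoc _ _ _ ⟨
      (x + 1#) + (- 1# + - y)          ≡⟨ cong₂ _+_ (+-comm _ _) (⁻¹-∙-comm 1# y) ⟩
      (1# + x) + - (1# + y)            ∎

  ι-⊖ : ∀ m n → ι (m ⊖ n) ≡ m · 1# + - (n · 1#)
  ι-⊖ m       zero    = sym (trans (cong (m · 1# +_) -0#≈0#) (+-identityʳ _))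
  ι-⊖ zero    (suc n) = sym (+-identityˡ _)
  ι-⊖ (suc m) (suc n) = trans (cong ι (ℤ.[1+m]⊖[1+n]≡m⊖n m n)) (trans (ι-⊖ m n) (cancel-1 _ _))

  ι-+ : ∀ i j → ι (i ℤ.+ j) ≡ ι i + ι j
  ι-+ (pos m)    (pos n)    = ×-homo-+ 1# m n
  ι-+ (pos m)    -[1+ n ] = ι-⊖ m (suc n)
  ι-+ -[1+ m ] (pos n)    = trans (ι-⊖ n (suc m)) (+-comm _ _)
  ι-+ -[1+ m ] -[1+ n ] = begin
    - (suc (suc (m ℕ.+ n)) · 1#)          ≡⟨ cong (λ k → - (k · 1#)) (ℕ.+-suc (suc m) n) ⟨
    - ((suc m ℕ.+ suc n) · 1#)            ≡⟨ cong -_ (×-homo-+ 1# (suc m) (suc n)) ⟩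
    - (suc m · 1# + suc n · 1#)           ≡⟨ ⁻¹-∙-comm _ _ ⟨
    - (suc m · 1#) + - (suc n · 1#)       ∎

  private
    ι-*-pos : ∀ m n → ι (pos m ℤ.* pos n) ≡ m · 1# * n · 1#
    ι-*-pos m n = trans (cong ι (sym (ℤ.pos-* m n))) (×1-homo-* m n)

  ι-* : ∀ i j → ι (i ℤ.* j) ≡ ι i * ι j
  ι-* (pos m)    (pos n)    = ι-*-pos m n
  ι-* (pos m)    -[1+ n ] = begin
    ι (pos m ℤ.* ℤ.- (pos (suc n)))   ≡⟨ cong ι (ℤ.neg-distribʳ-* (pos m) (pos (suc n))) ⟨
    ι (ℤ.- (pos m ℤ.* pos (suc n)))   ≡⟨ ι-neg (pos m ℤ.* pos (suc n)) ⟩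
    - ι (pos m ℤ.* pos (suc n))       ≡⟨ cong -_ (ι-*-pos m (suc n)) ⟩
    - (m · 1# * suc n · 1#)     ≡⟨ -‿distribʳ-* _ _ ⟩
    m · 1# * - (suc n · 1#)     ∎
  ι-* -[1+ m ] (pos n)    = begin
    ι (ℤ.- (pos (suc m)) ℤ.* pos n)   ≡⟨ cong ι (ℤ.neg-distribˡ-* (pos (suc m)) (pos n)) ⟨
    ι (ℤ.- (pos (suc m) ℤ.* pos n))   ≡⟨ ι-neg (pos (suc m) ℤ.* pos n) ⟩
    - ι (pos (suc m) ℤ.* pos n)       ≡⟨ cong -_ (ι-*-pos (suc m) n) ⟩
    - (suc m · 1# * n · 1#)     ≡⟨ -‿distribˡ-* _ _ ⟩
    - (suc m · 1#) * n · 1#     ∎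
  ι-* -[1+ m ] -[1+ n ] = begin
    ι (pos (suc m) ℤ.* pos (suc n))                ≡⟨ ι-*-pos (suc m) (suc n) ⟩
    suc m · 1# * suc n · 1#                ≡⟨ ⁻¹-involutive _ ⟨
    - - (suc m · 1# * suc n · 1#)          ≡⟨ cong -_ (-‿distribʳ-* _ _) ⟩
    - (suc m · 1# * - (suc n · 1#))        ≡⟨ -‿distribˡ-* _ _ ⟩
    - (suc m · 1#) * - (suc n · 1#)        ∎

  ι-homomorphism : ℤ.+-*-rawRing -Raw-AlmostCommutative⟶ fromCommutativeRing commutativeRing
  ι-homomorphism = record
    { ⟦_⟧    = ι
    ; +-homo = ι-+
    ; *-homo = ι-*
    ; -‿homo = ι-neg
    ; 0-homo = refl
    ; 1-homo = +-identityʳ 1#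
    }

  ι-≟ : WeaklyDecidable (λ i j → ι i ≡ ι j)
  ι-≟ i j with i ℤ.≟ j
  ... | yes i≡j = just (cong ι i≡j)
  ... | no _    = nothing

  open RingSolver ℤ.+-*-rawRing (fromCommutativeRing commutativeRing) ι-homomorphism ι-≟ public
    using (solve; _:=_; _:+_; _:*_; _:-_; :-_; con; Polynomial)

  *-integral : ∀ {x y} → x * y ≡ 0# → x ≢ 0# → y ≡ 0#
  *-integral {x} {y} xy≡0 x≢0 with inverse x x≢0
  ... | z , xz≡1 = begin
    y             ≡⟨ *-identityˡ y ⟨
    1# * y        ≡⟨ cong (_* y) xz≡1 ⟨
    x * z * y     ≡⟨ solve 3 (λ x y z → x :* z :* y := z :* (x :* y)) refl x y z ⟩
    z * (x * y)   ≡⟨ cong (z *_) xy≡0 ⟩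
    z * 0#        ≡⟨ zeroʳ z ⟩
    0#            ∎

  *-nonzero : ∀ {x y} → x ≢ 0# → y ≢ 0# → x * y ≢ 0#
  *-nonzero x≢0 y≢0 xy≡0 = y≢0 (*-integral xy≡0 x≢0)

  1≢0 : 1# ≢ 0#
  1≢0 = 0≢1 ∘ sym

  x-y≡0⇒x≡y : ∀ {x y} → x + - y ≡ 0# → x ≡ y
  x-y≡0⇒x≡y {x} {y} e = begin
    x               ≡⟨ solve 2 (λ x y → x := (x :- y) :+ y) refl x y ⟩
    (x + - y) + y   ≡⟨ cong (_+ y) e ⟩
    0# + y          ≡⟨ +-identityˡ y ⟩
    y               ∎

  *-cancelˡ : ∀ {x y z} → x ≢ 0# → x * y ≡ x * z → y ≡ z
  *-cancelˡ {x} {y} {z} x≢0 e = x-y≡0⇒x≡y (*-integral (begin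
    x * (y + - z)         ≡⟨ solve 3 (λ x y z → x :* (y :- z) := x :* y :- x :* z) refl x y z ⟩
    x * y + - (x * z)     ≡⟨ cong (λ w → w + - (x * z)) e ⟩
    x * z + - (x * z)     ≡⟨ -‿inverseʳ _ ⟩
    0#                    ∎) x≢0)

  square-roots : ∀ {x y} → x * x ≡ y * y → (x ≡ y) ⊎ (x ≡ - y)
  square-roots {x} {y} e with (x + - y) Fin.≟ 0#
  ... | yes x-y≡0 = inj₁ (x-y≡0⇒x≡y x-y≡0)
  ... | no  x-y≢0 = inj₂ (x-y≡0⇒x≡y (begin
    x + - - y   ≡⟨ cong (x +_) (⁻¹-involutive y) ⟩
    x + y       ≡⟨ *-integral (begin
      (x + - y) * (x + y)   ≡⟨ solve 2 (λ x y → (x :- y) :* (x :+ y) := x :* x :- y :* y) refl x y ⟩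
      x * x + - (y * y)     ≡⟨ cong (λ w → w + - (y * y)) e ⟩
      y * y + - (y * y)     ≡⟨ -‿inverseʳ _ ⟩
      0#                    ∎) x-y≢0 ⟩
    0#          ∎))

  private
    translation : Perm.Permutation q q
    translation = Perm.permutation (_+ 1#) (_+ - 1#)
      (λ x → solve 2 (λ x y → (x :- y) :+ y := x) refl x 1#)
      (λ x → solve 2 (λ x y → (x :+ y) :- y := x) refl x 1#)

  -- Summing all elements of the field is invariant under the translation x ↦ x + 1.
  q·1≡0 : q · 1# ≡ 0#
  q·1≡0 = ∙-cancelˡ (sum id) _ _ (begin
    sum id + q · 1#                ≡⟨ cong (sum id +_) (sum-replicate q) ⟨
    sum id + sum {q} (λ _ → 1#)    ≡⟨ ∑-distrib-+ id (λ _ → 1#) ⟨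
    sum (_+ 1#)                    ≡⟨ sum-permute id translation ⟨
    sum id                         ≡⟨ +-identityʳ _ ⟨
    sum id + 0#                    ∎)

  private
    bezout-absurd : ∀ {m n} x y → m · 1# ≡ 0# → n · 1# ≡ 0# → 1 ℕ.+ y ℕ.* n ≢ x ℕ.* m
    bezout-absurd {m} {n} x y m·1≡0 n·1≡0 eq = 1≢0 (begin
      1#                     ≡⟨ +-identityʳ 1# ⟨
      1# + 0#                ≡⟨ cong (1# +_) (multiple y n·1≡0) ⟨
      1# + (y ℕ.* n) · 1#    ≡⟨ cong (_· 1#) eq ⟩
      (x ℕ.* m) · 1#         ≡⟨ multiple x m·1≡0 ⟩
      0#                     ∎)
      where
      multiple : ∀ k {m} → m · 1# ≡ 0# → (k ℕ.* m) · 1# ≡ 0#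
      multiple k {m} m·1≡0 = trans (×1-homo-* k m) (trans (cong (k · 1# *_) m·1≡0) (zeroʳ _))

  -- Since `q · 1#` vanishes and r is coprime to q, the vanishing of `r · 1#` would make `1#` vanish
  -- by Bézout. This replaces a theory of the characteristic.
  ι-prime≢0 : ∀ {r} → Prime r → ¬ (r ∣ q) → ι (pos r) ≢ 0#
  ι-prime≢0 {r} r-prime r∤q r·1≡0 with coprime-Bézout {r} {q} coprime
    where
    coprime : ∀ {d} → d ∣ r × d ∣ q → d ≡ 1
    coprime (d∣r , d∣q) with prime⇒irreducible r-prime d∣r
    ... | inj₁ d≡1  = d≡1
    ... | inj₂ refl = ⊥-elim (r∤q d∣q)
  ... | Bézout.+- x y eq = bezout-absurd x y r·1≡0 q·1≡0 eq
  ... | Bézout.-+ x y eq = bezout-absurd y x q·1≡0 r·1≡0 eq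

-- Integral matrices and the search over sign patterns.

Matrix : ℕ → Set
Matrix m = Vec (Vec ℤ m) m

entry : ∀ {m} → Matrix m → Fin m → Fin m → ℤ
entry G i j = lookup (lookup G i) j

Σℤ : ∀ {m} → (Fin m → ℤ) → ℤ
Σℤ {zero}  f = 0ℤ
Σℤ {suc m} f = f zero ℤ.+ Σℤ (λ i → f (suc i))

altΣ : ∀ {m} → (Fin m → ℤ) → ℤ
altΣ {zero}  f = 0ℤ
altΣ {suc m} f = f zero ℤ.- altΣ (λ i → f (suc i))

minor : ∀ {m} → Matrix (suc m) → Fin (suc m) → Fin (suc m) → Matrix m
minor G i j = Vec.map (λ r → Vec.removeAt r j) (Vec.removeAt G i)

determinant : ∀ {m} → Matrix m → ℤ
determinant {zero}  G = 1ℤ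
determinant {suc m} G = altΣ λ j → entry G zero j ℤ.* determinant (minor G zero j)

sgn : ∀ {m} → Fin m → ℤ
sgn zero    = 1ℤ
sgn (suc i) = ℤ.- sgn i

-- Because of the transposed indices this is the adjugate. No property of it is proved: it proposes
-- a candidate, which `isInverse?` checks by multiplication.
cofactors : ∀ {m} → Matrix (suc m) → Matrix (suc m)
cofactors G = tabulate λ i → tabulate λ j →
  sgn i ℤ.* (sgn j ℤ.* determinant (minor G j i))

-- The value for a zero divisor is junk, and inexact quotients are rounded: `invertible` checks the result.
quotient : ℤ → ℤ → ℤ
quotient i (pos zero)      = 0ℤ
quotient i d@(pos (suc _)) = i ℤ./ d
quotient i d@(-[1+ _ ]) = i ℤ./ d

scaledInverse : ∀ {m} → ℤ → Matrix (suc m) → Matrix (suc m)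
scaledInverse N G = Vec.map (Vec.map (k ℤ.*_)) C
  where
  C = cofactors G
  -- The sum is the top left entry of G times its adjugate, that is the determinant.
  k = quotient N (Σℤ λ j → entry G zero j ℤ.* entry C j zero)

δℤ : ∀ {m} → ℤ → Fin m → Fin m → ℤ
δℤ N i j = if does (i Fin.≟ j) then N else 0ℤ

record IsInverse {m} (N : ℤ) (G C : Matrix m) : Set where
  constructor inverts
  field product : ∀ i k → Σℤ (λ j → entry G i j ℤ.* entry C j k) ≡ δℤ N i k

isInverse? : ∀ {m} N (G C : Matrix m) → Dec (IsInverse N G C)
isInverse? N G C = map′ inverts IsInverse.product (Fin.all? λ i → Fin.all? λ k → _ ℤ.≟ _)

-- 324 = 2² · 3⁴ is a multiple of all the Gram determinants ± 2ⁱ · 3ʲ that the search relies on.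
N : ℤ
N = pos 324

invertible : Matrix 5 → Bool
invertible G = isYes (isInverse? N G (scaledInverse N G))

invertible-sound : ∀ G → T (invertible G) → ∃[ C ] IsInverse N G C
invertible-sound G inv = scaledInverse N G , toWitness {a? = isInverse? N G (scaledInverse N G)} inv

choose : ∀ k m → List (Vec (Fin m) k)
choose zero    m       = [] ∷ []
choose (suc k) zero    = []
choose (suc k) (suc m) =
  List.map (λ s → zero ∷ Vec.map suc s) (choose k m) ++ List.map (Vec.map suc) (choose (suc k) m)

submatrix : ∀ {k m} → Matrix m → Vec (Fin m) k → Matrix k
submatrix G s = Vec.map (λ i → Vec.map (entry G i) s) s

-- A matrix is tagged by (whether it is the base matrix , which determinant it has).  `entries s t`
-- lists the possible scaled pairings of a matrix tagged s with a later one of type t; the pairings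
-- with the base matrix are made positive by replacing matrices by their negatives.
entries : Bool × Bool → Bool → List ℤ
entries (base , false) false = if base then 1ℤ ∷ [] else 1ℤ ∷ -1ℤ ∷ []
entries (base , true)  true  = if base then 1ℤ ∷ [] else 1ℤ ∷ -1ℤ ∷ []
entries (base , false) true  = 0ℤ ∷ []
entries (base , true)  false = 0ℤ ∷ []

rows : ∀ {m} → Vec (Bool × Bool) m → Bool → List (Vec ℤ m)
rows []       t = [] ∷ []
rows (s ∷ ss) t = cartesianProductWith _∷_ (entries s t) (rows ss t)

-- The diagonal entry 2 is the pairing of a matrix with itself divided by its determinant. The
-- newest matrix gets index zero.
border : ∀ {m} → Vec ℤ m → Matrix m → Matrix (suc m)
border r G = (pos 2 ∷ r) ∷ Vec.zipWith _∷_ r G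

-- Every tested submatrix contains the newest index; the others were tested at earlier stages.
newInvertible : ∀ {m} → Matrix m → Bool
newInvertible {zero}  G = false
newInvertible {suc m} G = any (λ s → invertible (submatrix G (zero ∷ Vec.map suc s))) (choose 4 m)

-- `refuted ss ts G` certifies that matrices tagged ss with scaled Gram matrix G cannot be continued
-- by matrices of types ts: however the signs are chosen, some 5×5 submatrix becomes invertible.
mutual
  refuted : ∀ {m} → Vec (Bool × Bool) m → List Bool → Matrix m → Bool
  refuted ss ts G = newInvertible G ∨ refutedNext ss ts G

  refutedNext : ∀ {m} → Vec (Bool × Bool) m → List Bool → Matrix m → Bool
  refutedNext ss []       G = false
  refutedNext ss (t ∷ ts) G = all (λ r → refuted ((false , t) ∷ ss) ts (border r G)) (rows ss t)

-- The base matrix has type `true` and is not listed in `ts`, so `replicate 3 true` stands for four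
-- matrices of that type.
refutedFrom : List Bool → Bool
refutedFrom ts = refuted ((true , true) ∷ []) ts ((pos 2 ∷ []) ∷ [])

-- Linear relations and Gram matrices over the finite field.

module LinearAlgebra {q : ℕ} (F : FiniteField q) where
  open FieldFacts F
  open ≡-Reasoning

  1<q : 1 < q
  1<q = Fin.injective⇒≤ {f = pick} pick-injective
    where
    pick : Fin 2 → Fin q
    pick zero    = 0#
    pick (suc _) = 1#
    pick-injective : ∀ {i j} → pick i ≡ pick j → i ≡ j
    pick-injective {zero}     {zero}     _ = refl
    pick-injective {zero}     {suc zero} e = contradiction (sym e) 1≢0
    pick-injective {suc zero} {zero}     e = contradiction e 1≢0
    pick-injective {suc zero} {suc zero} _ = refl

  funToFin-cong : ∀ {m} {f g : Fin m → Fin q} → f ≗ g → funToFin f ≡ funToFin g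
  funToFin-cong {zero}  f≗g = refl
  funToFin-cong {suc m} f≗g = cong₂ Fin.combine (f≗g zero) (funToFin-cong (f≗g ∘ suc))

  finToFun-separates : ∀ {m} {i j : Fin (q ^ m)} → i ≢ j → ∃[ k ] finToFun {q} {m} i k ≢ finToFun j k
  finToFun-separates {m} {i} {j} i≢j with Fin.all? (λ k → finToFun {q} {m} i k Fin.≟ finToFun j k)
  ... | yes same = contradiction (begin
    i                                   ≡⟨ Fin.funToFin-finToFin {m} {q} i ⟨
    funToFin (finToFun {q} {m} i)       ≡⟨ funToFin-cong same ⟩
    funToFin (finToFun {q} {m} j)       ≡⟨ Fin.funToFin-finToFin {m} {q} j ⟩
    j                                   ∎) i≢j
  ... | no differ = Fin.¬∀⟶∃¬ m _ (λ k → finToFun {q} {m} i k Fin.≟ finToFun j k) differ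

  sum-neg : ∀ {m} (f : Fin m → Fin q) → sum (λ i → - f i) ≡ - sum f
  sum-neg f = begin
    sum (λ i → - f i)        ≡⟨ sum-cong-≗ (λ i → solve 1 (λ x → :- x := con -1ℤ :* x) refl (f i)) ⟩
    sum (λ i → ι -1ℤ * f i)  ≡⟨ *-distribˡ-sum (ι -1ℤ) f ⟨
    ι -1ℤ * sum f            ≡⟨ solve 1 (λ x → :- x := con -1ℤ :* x) refl (sum f) ⟨
    - sum f                  ∎

  -- Two of the q^m coefficient vectors have the same combination, as there are only q^n values.
  linear-relation : ∀ {m n} → n < m → (V : Fin m → Fin n → Fin q) →
    ∃[ c ] (∃[ k ] c k ≢ 0#) × (∀ r → sum (λ i → c i * V i r) ≡ 0#)
  linear-relation {m} {n} n<m V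
    with Fin.pigeonhole (ℕ.^-monoʳ-< q 1<q n<m)
           (λ e → funToFin (λ r → sum (λ i → finToFun {q} {m} e i * V i r)))
  ... | e , e' , e<e' , same = c , nonzero , vanishes
    where
    d d' c : Fin m → Fin q
    d  = finToFun e
    d' = finToFun e'
    c i = d i + - d' i
    nonzero : ∃[ k ] c k ≢ 0#
    nonzero with finToFun-separates {m} (Fin.<⇒≢ e<e')
    ... | k , dk≢d'k = k , dk≢d'k ∘ x-y≡0⇒x≡y
    combination : (Fin m → Fin q) → Fin n → Fin q
    combination d r = sum (λ i → d i * V i r)
    agree : combination d ≗ combination d'
    agree r = begin
      combination d r                             ≡⟨ Fin.finToFun-funToFin (combination d) r ⟨
      finToFun (funToFin (combination d)) r       ≡⟨ cong (λ x → finToFun x r) same ⟩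
      finToFun (funToFin (combination d')) r      ≡⟨ Fin.finToFun-funToFin (combination d') r ⟩
      combination d' r                            ∎
    vanishes : ∀ r → sum (λ i → c i * V i r) ≡ 0#
    vanishes r = begin
      sum (λ i → c i * V i r)
        ≡⟨ sum-cong-≗ (λ i → solve 3 (λ x y z → (x :- y) :* z := x :* z :+ :- (y :* z)) refl (d i) (d' i) (V i r)) ⟩
      sum (λ i → d i * V i r + - (d' i * V i r))
        ≡⟨ ∑-distrib-+ (λ i → d i * V i r) (λ i → - (d' i * V i r)) ⟩
      combination d r + sum (λ i → - (d' i * V i r))
        ≡⟨ cong₂ _+_ (agree r) (sum-neg (λ i → d' i * V i r)) ⟩
      combination d' r + - combination d' r
        ≡⟨ -‿inverseʳ _ ⟩
      0# ∎

  -- The polarisation of the determinant.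
  ⟪_,_⟫ : M2 q → M2 q → Fin q
  ⟪ mat a b c d , mat a' b' c' d' ⟫ = (a * d' + d * a') + - (b * c' + c * b')

  coordinate : Fin 4 → M2 q → Fin q
  coordinate zero                   = M2.a
  coordinate (suc zero)             = M2.b
  coordinate (suc (suc zero))       = M2.c
  coordinate (suc (suc (suc zero))) = M2.d

  -- Shaped after the polarised determinant: f, g, h, k are the coordinates a, b, c, d of the
  -- varying matrix, while x, y, z, w are the coordinates d, a, c, b of the fixed one.
  sum-linear : ∀ {m} (c f g h k : Fin m → Fin q) x y z w →
    sum (λ i → c i * ((f i * x + k i * y) + - (g i * z + h i * w))) ≡
    (sum (λ i → c i * f i) * x + sum (λ i → c i * k i) * y) + - (sum (λ i → c i * g i) * z + sum (λ i → c i * h i) * w)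
  sum-linear {zero}  c f g h k x y z w =
    solve 4 (λ x y z w → con 0ℤ := (con 0ℤ :* x :+ con 0ℤ :* y) :- (con 0ℤ :* z :+ con 0ℤ :* w)) refl x y z w
  sum-linear {suc m} c f g h k x y z w = begin
    c zero * ((f zero * x + k zero * y) + - (g zero * z + h zero * w)) + rest
      ≡⟨ cong₂ _+_
           (solve 9 (λ c f g h k x y z w → c :* ((f :* x :+ k :* y) :- (g :* z :+ h :* w)) :=
             (c :* f :* x :+ c :* k :* y) :- (c :* g :* z :+ c :* h :* w))
             refl (c zero) (f zero) (g zero) (h zero) (k zero) x y z w)
           (sum-linear (c ∘ suc) (f ∘ suc) (g ∘ suc) (h ∘ suc) (k ∘ suc) x y z w) ⟩
    ((f₀ * x + k₀ * y) + - (g₀ * z + h₀ * w)) + ((f₁ * x + k₁ * y) + - (g₁ * z + h₁ * w))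
      ≡⟨ solve 8 (λ f k g h f' k' g' h' → ((f :+ k) :- (g :+ h)) :+ ((f' :+ k') :- (g' :+ h')) :=
           ((f :+ f') :+ (k :+ k')) :- ((g :+ g') :+ (h :+ h')))
           refl (f₀ * x) (k₀ * y) (g₀ * z) (h₀ * w) (f₁ * x) (k₁ * y) (g₁ * z) (h₁ * w) ⟩
    ((f₀ * x + f₁ * x) + (k₀ * y + k₁ * y)) + - ((g₀ * z + g₁ * z) + (h₀ * w + h₁ * w))
      ≡⟨ cong₂ (λ s t → s + - t)
           (cong₂ _+_ (distribʳ x f₀ f₁) (distribʳ y k₀ k₁))
           (cong₂ _+_ (distribʳ z g₀ g₁) (distribʳ w h₀ h₁)) ⟨
    ((f₀ + f₁) * x + (k₀ + k₁) * y) + - ((g₀ + g₁) * z + (h₀ + h₁) * w) ∎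
    where
    f₀ = c zero * f zero
    g₀ = c zero * g zero
    h₀ = c zero * h zero
    k₀ = c zero * k zero
    f₁ = sum (λ i → c (suc i) * f (suc i))
    g₁ = sum (λ i → c (suc i) * g (suc i))
    h₁ = sum (λ i → c (suc i) * h (suc i))
    k₁ = sum (λ i → c (suc i) * k (suc i))
    rest = sum (λ i → c (suc i) * ((f (suc i) * x + k (suc i) * y) + - (g (suc i) * z + h (suc i) * w)))

  combination : ∀ {m} → (Fin m → Fin q) → (Fin m → M2 q) → M2 q
  combination c A = mat (total M2.a) (total M2.b) (total M2.c) (total M2.d)
    where
    total : (M2 q → Fin q) → Fin q
    total coord = sum (λ i → c i * coord (A i))

  ⟪combination,⟫ : ∀ {m} (c : Fin m → Fin q) A B → sum (λ i → c i * ⟪ A i , B ⟫) ≡ ⟪ combination c A , B ⟫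
  ⟪combination,⟫ c A (mat x y z w) = sum-linear c (M2.a ∘ A) (M2.b ∘ A) (M2.c ∘ A) (M2.d ∘ A) w x z y

  ⟪0,⟫ : ∀ {A} B → (∀ r → coordinate r A ≡ 0#) → ⟪ A , B ⟫ ≡ 0#
  ⟪0,⟫ {mat a b c d} (mat x y z w) A≡0
    with refl ← A≡0 zero | refl ← A≡0 (suc zero) | refl ← A≡0 (suc (suc zero)) | refl ← A≡0 (suc (suc (suc zero))) =
    solve 4 (λ x y z w → (con 0ℤ :* w :+ con 0ℤ :* x) :- (con 0ℤ :* z :+ con 0ℤ :* y) := con 0ℤ) refl x y z w

  -- The space of 2×2 matrices has dimension four. The relation is kept only through its pairings,
  -- which is all that a Gram matrix sees.
  matrix-relation : (A : Fin 5 → M2 q) →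
    ∃[ c ] (∃[ k ] c k ≢ 0#) × (∀ B → sum (λ i → c i * ⟪ A i , B ⟫) ≡ 0#)
  matrix-relation A =
    let c , c≢0 , vanishes = linear-relation (ℕ.n<1+n 4) (λ i r → coordinate r (A i))
    in c , c≢0 , λ B → trans (⟪combination,⟫ c A B) (⟪0,⟫ {combination c A} B λ where
      zero                   → vanishes zero
      (suc zero)             → vanishes (suc zero)
      (suc (suc zero))       → vanishes (suc (suc zero))
      (suc (suc (suc zero))) → vanishes (suc (suc (suc zero))))

  ι-Σ : ∀ {m} (f : Fin m → ℤ) → ι (Σℤ f) ≡ sum (ι ∘ f)
  ι-Σ {zero}  f = refl
  ι-Σ {suc m} f = trans (ι-+ (f zero) _) (cong (ι (f zero) +_) (ι-Σ (f ∘ suc)))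

  sum-δℤ : ∀ {m} N (c : Fin m → Fin q) k → sum (λ i → c i * ι (δℤ N i k)) ≡ c k * ι N
  sum-δℤ N c zero    = trans (cong (c zero * ι N +_) (zeros (c ∘ suc))) (+-identityʳ _)
    where
    zeros : ∀ {m} (c : Fin m → Fin q) → sum (λ i → c i * 0#) ≡ 0#
    zeros {zero}  c = refl
    zeros {suc m} c = trans (cong₂ _+_ (zeroʳ _) (zeros (c ∘ suc))) (+-identityʳ 0#)
  sum-δℤ N c (suc k) = trans (cong₂ _+_ (zeroʳ _) (sum-δℤ N (c ∘ suc) k)) (+-identityˡ _)

  -- A relation Σ cᵢ Aᵢ = 0 gives Σᵢ cᵢ Gᵢⱼ = 0 for every j, hence N cₖ = 0.
  relation-zero : ∀ {m N} (A : Fin m → M2 q) (c w : Fin m → Fin q) → (∀ B → sum (λ i → c i * ⟪ A i , B ⟫) ≡ 0#) →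
    (∀ j → w j ≢ 0#) → (G C : Matrix m) → (∀ i j → ⟪ A i , A j ⟫ ≡ ι (entry G i j) * w j) → IsInverse N G C →
    ∀ k → c k * ι N ≡ 0#
  relation-zero {m} {N} A c w vanishes w≢0 G C gram inv k = begin
    c k * ι N                                                      ≡⟨ sum-δℤ N c k ⟨
    sum (λ i → c i * ι (δℤ N i k))                                 ≡⟨ sum-cong-≗ (λ i → cong (c i *_) (expand i)) ⟨
    sum (λ i → c i * sum (λ j → g i j * ι (entry C j k)))          ≡⟨ sum-cong-≗ (λ i → *-distribˡ-sum (c i) (λ j → g i j * ι (entry C j k))) ⟩
    sum (λ i → sum (λ j → c i * (g i j * ι (entry C j k))))        ≡⟨ ∑-comm (λ i j → c i * (g i j * ι (entry C j k))) ⟩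
    sum (λ j → sum (λ i → c i * (g i j * ι (entry C j k))))        ≡⟨ sum-cong-≗ (λ j → sum-cong-≗ (λ i → *-assoc (c i) (g i j) _)) ⟨
    sum (λ j → sum (λ i → c i * g i j * ι (entry C j k)))          ≡⟨ sum-cong-≗ (λ j → *-distribʳ-sum (ι (entry C j k)) (λ i → c i * g i j)) ⟨
    sum (λ j → sum (λ i → c i * g i j) * ι (entry C j k))          ≡⟨ sum-cong-≗ (λ j → cong (_* ι (entry C j k)) (column j)) ⟩
    sum {m} (λ j → 0# * ι (entry C j k))                           ≡⟨ *-distribˡ-sum 0# (λ j → ι (entry C j k)) ⟨
    0# * sum (λ j → ι (entry C j k))                               ≡⟨ zeroˡ _ ⟩
    0#                                                             ∎
    where
    g : Fin m → Fin m → Fin q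
    g i j = ι (entry G i j)
    expand : ∀ i → sum (λ j → g i j * ι (entry C j k)) ≡ ι (δℤ N i k)
    expand i = begin
      sum (λ j → g i j * ι (entry C j k))           ≡⟨ sum-cong-≗ (λ j → ι-* (entry G i j) (entry C j k)) ⟨
      sum (λ j → ι (entry G i j ℤ.* entry C j k))   ≡⟨ ι-Σ (λ j → entry G i j ℤ.* entry C j k) ⟨
      ι (Σℤ (λ j → entry G i j ℤ.* entry C j k))    ≡⟨ cong ι (IsInverse.product inv i k) ⟩
      ι (δℤ N i k)                                  ∎
    column : ∀ j → sum (λ i → c i * g i j) ≡ 0#
    column j = *-integral (begin
      w j * sum (λ i → c i * g i j)        ≡⟨ *-comm _ _ ⟩
      sum (λ i → c i * g i j) * w j        ≡⟨ *-distribʳ-sum (w j) (λ i → c i * g i j) ⟩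
      sum (λ i → c i * g i j * w j)        ≡⟨ sum-cong-≗ (λ i → *-assoc (c i) (g i j) (w j)) ⟩
      sum (λ i → c i * (g i j * w j))      ≡⟨ sum-cong-≗ (λ i → cong (c i *_) (gram i j)) ⟨
      sum (λ i → c i * ⟪ A i , A j ⟫)      ≡⟨ vanishes (A j) ⟩
      0#                                   ∎) (w≢0 j)

  gram-not-invertible : ∀ {N} → ι N ≢ 0# → (A : Fin 5 → M2 q) (w : Fin 5 → Fin q) → (∀ j → w j ≢ 0#) →
    (G C : Matrix 5) → (∀ i j → ⟪ A i , A j ⟫ ≡ ι (entry G i j) * w j) → ¬ IsInverse N G C
  gram-not-invertible N≢0 A w w≢0 G C gram inv =
    let c , (k , ck≢0) , vanishes = matrix-relation A
    in *-nonzero ck≢0 N≢0 (relation-zero A c w vanishes w≢0 G C gram inv k)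

-- From the integral search to families of matrices over the field.

entry-submatrix : ∀ {k m} (G : Matrix m) (s : Vec (Fin m) k) i j →
  entry (submatrix G s) i j ≡ entry G (lookup s i) (lookup s j)
entry-submatrix G s i j =
  trans (cong (λ r → lookup r j) (Vec.lookup-map i (λ i → Vec.map (entry G i) s) s))
        (Vec.lookup-map j (entry G (lookup s i)) s)

entry-border-column : ∀ {m} (r : Vec ℤ m) G i → entry (border r G) (suc i) zero ≡ lookup r i
entry-border-column r G i = cong (λ v → lookup v zero) (Vec.lookup-zipWith _∷_ i r G)

entry-border : ∀ {m} (r : Vec ℤ m) G i j → entry (border r G) (suc i) (suc j) ≡ entry G i j
entry-border r G i j = cong (λ v → lookup v (suc j)) (Vec.lookup-zipWith _∷_ i r G)

rows-complete : ∀ {m} (ss : Vec (Bool × Bool) m) t (P : Fin m → ℤ → Set) →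
  (∀ i → ∃[ e ] e ∈ entries (lookup ss i) t × P i e) → ∃[ r ] r ∈ rows ss t × (∀ i → P i (lookup r i))
rows-complete []       t P choice = [] , here refl , λ ()
rows-complete (s ∷ ss) t P choice
  with choice zero | rows-complete ss t (P ∘ suc) (choice ∘ suc)
... | e , e∈ , Pe | r , r∈ , Pr = e ∷ r , ∈-cartesianProductWith⁺ _∷_ e∈ r∈ , λ where
  zero    → Pe
  (suc i) → Pr i

module Families {q : ℕ} (F : FiniteField q) (N≢0 : FieldFacts.ι F N ≢ FiniteField.0F F) where
  open FieldFacts F
  open LinearAlgebra F
  open ≡-Reasoning

  ⟪⟫-sym : ∀ A B → ⟪ A , B ⟫ ≡ ⟪ B , A ⟫
  ⟪⟫-sym (mat a b c d) (mat a' b' c' d') =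
    solve 8 (λ a b c d a' b' c' d' → (a :* d' :+ d :* a') :- (b :* c' :+ c :* b') :=
                                     (a' :* d :+ d' :* a) :- (b' :* c :+ c' :* b))
      refl a b c d a' b' c' d'

  negM : M2 q → M2 q
  negM (mat a b c d) = mat (- a) (- b) (- c) (- d)

  ⟪neg,⟫ : ∀ A B → ⟪ negM A , B ⟫ ≡ - ⟪ A , B ⟫
  ⟪neg,⟫ (mat a b c d) (mat a' b' c' d') =
    solve 8 (λ a b c d a' b' c' d' → (:- a :* d' :+ :- d :* a') :- (:- b :* c' :+ :- c :* b') :=
                                     :- ((a :* d' :+ d :* a') :- (b :* c' :+ c :* b')))
      refl a b c d a' b' c' d'

  module Typed (δ : Bool → Fin q) (δ≢0 : ∀ t → δ t ≢ 0#) where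

    Norm : Bool × M2 q → Set
    Norm (t , A) = ⟪ A , A ⟫ ≡ ι (pos 2) * δ t

    Rel : Bool × Bool → M2 q → Bool × M2 q → Set
    Rel s A (t , B) = ∃[ e ] e ∈ entries s t × ⟪ B , A ⟫ ≡ ι e * δ (proj₂ s)

    RelPair : Bool × M2 q → Bool × M2 q → Set
    RelPair (s , A) = Rel (false , s) A

    -- The weight of column j is taken out of the true Gram matrix, so that G can be integral and
    -- symmetric although the two weights are unrelated field elements.
    Gram : ∀ {m} → Vec (Bool × Bool) m → Vec (M2 q) m → Matrix m → Set
    Gram ss As G = ∀ i j → ⟪ lookup As i , lookup As j ⟫ ≡ ι (entry G i j) * δ (proj₂ (lookup ss j))

    -- Matrices of different types have pairing zero, so it is immaterial whether the weight of the
    -- row or of the column is used.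
    entries-weight : ∀ s t {e} → e ∈ entries s t → ι e * δ (proj₂ s) ≡ ι e * δ t
    entries-weight (_ , false) false e∈          = refl
    entries-weight (_ , true)  true  e∈          = refl
    entries-weight (_ , false) true  (here refl) = trans (zeroˡ _) (sym (zeroˡ _))
    entries-weight (_ , true)  false (here refl) = trans (zeroˡ _) (sym (zeroˡ _))

    border-Gram : ∀ {m} (ss : Vec (Bool × Bool) m) As G t B r → Gram ss As G → Norm (t , B) →
      (∀ i → (⟪ B , lookup As i ⟫ ≡ ι (lookup r i) * δ (proj₂ (lookup ss i))) × (⟪ lookup As i , B ⟫ ≡ ι (lookup r i) * δ t)) →
      Gram ((false , t) ∷ ss) (B ∷ As) (border r G)
    border-Gram ss As G t B r gram norm row zero    zero    = norm
    border-Gram ss As G t B r gram norm row zero    (suc j) = proj₁ (row j)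
    border-Gram ss As G t B r gram norm row (suc i) zero    =
      trans (proj₂ (row i)) (cong (λ e → ι e * δ t) (sym (entry-border-column r G i)))
    border-Gram ss As G t B r gram norm row (suc i) (suc j) =
      trans (gram i j) (cong (λ e → ι e * δ (proj₂ (lookup ss j))) (sym (entry-border r G i j)))

    extend : ∀ {m} (ss : Vec (Bool × Bool) m) As G u → Gram ss As G → Norm u →
      (∀ i → Rel (lookup ss i) (lookup As i) u) →
      ∃[ r ] r ∈ rows ss (proj₁ u) × Gram ((false , proj₁ u) ∷ ss) (proj₂ u ∷ As) (border r G)
    extend ss As G (t , B) gram norm rel =
      let r , r∈ , row = rows-complete ss t
             (λ i e → (⟪ B , lookup As i ⟫ ≡ ι e * δ (proj₂ (lookup ss i))) × (⟪ lookup As i , B ⟫ ≡ ι e * δ t))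
             (λ i → let e , e∈ , eq = rel i in e , e∈ , eq ,
               trans (⟪⟫-sym (lookup As i) B) (trans eq (entries-weight (lookup ss i) t e∈)))
      in r , r∈ , border-Gram ss As G t B r gram norm row

    invertible-absurd : ∀ {m} (ss : Vec (Bool × Bool) m) As G (s : Vec (Fin m) 5) → Gram ss As G →
      ¬ T (invertible (submatrix G s))
    invertible-absurd ss As G s gram inv =
      let C , GC≡N = invertible-sound (submatrix G s) inv
      in gram-not-invertible N≢0 (λ i → lookup As (lookup s i)) (λ j → δ (proj₂ (lookup ss (lookup s j)))) (λ j → δ≢0 _)
        (submatrix G s) C
        (λ i j → trans (gram (lookup s i) (lookup s j))
          (cong (λ e → ι e * δ (proj₂ (lookup ss (lookup s j)))) (sym (entry-submatrix G s i j))))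
        GC≡N

    newInvertible-absurd : ∀ {m} (ss : Vec (Bool × Bool) m) As G → Gram ss As G → ¬ T (newInvertible G)
    newInvertible-absurd {suc m} ss As G gram new =
      let s , inv = Any.satisfied (Any.any⁻ (λ s → invertible (submatrix G (zero ∷ Vec.map suc s))) (choose 4 m) new)
      in invertible-absurd ss As G (zero ∷ Vec.map suc s) gram inv

    mutual
      -- Follows the one branch of the search tree whose signs are those of the actual matrices; it
      -- ends at an invertible submatrix, against the linear dependence of five matrices.
      refuted-absurd : ∀ {m} (ss : Vec (Bool × Bool) m) As G us → Gram ss As G →
        (∀ i → All (Rel (lookup ss i) (lookup As i)) us) → AllPairs RelPair us → All Norm us →
        T (refuted ss (List.map proj₁ us) G) → ⊥
      refuted-absurd ss As G us gram rel pairs norms ref =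
        [ newInvertible-absurd ss As G gram , refutedNext-absurd ss As G us gram rel pairs norms ]
          (Equivalence.to (Bool.T-∨ {newInvertible G}) ref)

      refutedNext-absurd : ∀ {m} (ss : Vec (Bool × Bool) m) As G us → Gram ss As G →
        (∀ i → All (Rel (lookup ss i) (lookup As i)) us) → AllPairs RelPair us → All Norm us →
        T (refutedNext ss (List.map proj₁ us) G) → ⊥
      refutedNext-absurd ss As G (u ∷ us) gram rel (uus ∷ pairs) (norm ∷ norms) next =
        let r , r∈ , gram′ = extend ss As G u gram norm (All.head ∘ rel)
        in refuted-absurd ((false , proj₁ u) ∷ ss) (proj₂ u ∷ As) (border r G) us gram′
             (λ { zero → uus ; (suc i) → All.tail (rel i) })
             pairs norms
             (All.lookup (All.all⁺ (λ r → refuted ((false , proj₁ u) ∷ ss) (List.map proj₁ us) (border r G))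
               (rows ss (proj₁ u)) next) r∈)

    Rel-negˡ : ∀ s A u → Rel (false , s) A u → Rel (false , s) (negM A) u
    Rel-negˡ s A (t , B) (e , e∈ , eq) = ℤ.- e , closed s t e∈ , (begin
      ⟪ B , negM A ⟫       ≡⟨ ⟪⟫-sym B (negM A) ⟩
      ⟪ negM A , B ⟫       ≡⟨ ⟪neg,⟫ A B ⟩
      - ⟪ A , B ⟫          ≡⟨ cong -_ (trans (⟪⟫-sym A B) eq) ⟩
      - (ι e * δ s)        ≡⟨ solve 2 (λ x y → :- (x :* y) := :- x :* y) refl (ι e) (δ s) ⟩
      - ι e * δ s          ≡⟨ cong (_* δ s) (ι-neg e) ⟨
      ι (ℤ.- e) * δ s      ∎)
      where
      closed : ∀ s t {e} → e ∈ entries (false , s) t → ℤ.- e ∈ entries (false , s) t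
      closed false false (here refl)         = there (here refl)
      closed false false (there (here refl)) = here refl
      closed true  true  (here refl)         = there (here refl)
      closed true  true  (there (here refl)) = here refl
      closed false true  (here refl)         = here refl
      closed true  false (here refl)         = here refl

    RelPair-sym : ∀ {u v} → RelPair u v → RelPair v u
    RelPair-sym {s , A} {t , B} (e , e∈ , eq) =
      e , subst (e ∈_) (entries-sym s t) e∈ , trans (⟪⟫-sym A B) (trans eq (entries-weight (false , s) t e∈))
      where
      entries-sym : ∀ s t → entries (false , s) t ≡ entries (false , t) s
      entries-sym false false = refl
      entries-sym false true  = refl
      entries-sym true  false = refl
      entries-sym true  true  = refl

    -- Negation preserves determinants and the set of admissible pairings, so this normalisation is
    -- harmless. It halves the choices for each later matrix of the base type.
    orient : M2 q → Bool × M2 q → Bool × M2 q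
    orient B (t , A) = t , (if does (⟪ A , B ⟫ Fin.≟ - δ true) then negM A else A)

    orient-Rel : ∀ B u v → RelPair u v → RelPair (orient B u) v
    orient-Rel B (t , A) v rel with does (⟪ A , B ⟫ Fin.≟ - δ true)
    ... | true  = Rel-negˡ t A v rel
    ... | false = rel

    orient-Norm : ∀ B u → Norm u → Norm (orient B u)
    orient-Norm B (t , A) norm with does (⟪ A , B ⟫ Fin.≟ - δ true)
    ... | false = norm
    ... | true  = begin
      ⟪ negM A , negM A ⟫   ≡⟨ ⟪neg,⟫ A (negM A) ⟩
      - ⟪ A , negM A ⟫      ≡⟨ cong -_ (trans (⟪⟫-sym A (negM A)) (⟪neg,⟫ A A)) ⟩
      - - ⟪ A , A ⟫         ≡⟨ solve 1 (λ x → :- (:- x) := x) refl ⟪ A , A ⟫ ⟩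
      ⟪ A , A ⟫             ≡⟨ norm ⟩
      ι (pos 2) * δ t       ∎

    orient-base : ∀ B u → RelPair (true , B) u → Rel (true , true) B (orient B u)
    orient-base B (false , A) (_ , here refl , eq) with does (⟪ A , B ⟫ Fin.≟ - δ true)
    ... | false = 0ℤ , here refl , eq
    ... | true  = 0ℤ , here refl , (begin
      ⟪ negM A , B ⟫     ≡⟨ ⟪neg,⟫ A B ⟩
      - ⟪ A , B ⟫        ≡⟨ cong -_ eq ⟩
      - (0# * δ true)    ≡⟨ solve 1 (λ x → :- (con 0ℤ :* x) := con 0ℤ :* x) refl (δ true) ⟩
      0# * δ true        ∎)
    orient-base B (true , A) (e , e∈ , eq) with ⟪ A , B ⟫ Fin.≟ - δ true
    ... | yes ⟪A,B⟫≡-δ = 1ℤ , here refl , (begin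
      ⟪ negM A , B ⟫     ≡⟨ ⟪neg,⟫ A B ⟩
      - ⟪ A , B ⟫        ≡⟨ cong -_ ⟪A,B⟫≡-δ ⟩
      - - δ true         ≡⟨ solve 1 (λ x → :- (:- x) := con 1ℤ :* x) refl (δ true) ⟩
      ι 1ℤ * δ true      ∎)
    orient-base B (true , A) (_ , here refl , eq)         | no _     = 1ℤ , here refl , eq
    orient-base B (true , A) (_ , there (here refl) , eq) | no ≢-δ = contradiction
      (trans eq (solve 1 (λ x → con -1ℤ :* x := :- x) refl (δ true))) ≢-δ

    refutedFrom-absurd : ∀ B us ts → List.map proj₁ us ≡ ts → Norm (true , B) →
      All (RelPair (true , B)) us → AllPairs RelPair us → All Norm us → ¬ T (refutedFrom ts)
    refutedFrom-absurd B us ts types norm base pairs norms ref =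
      refuted-absurd ((true , true) ∷ []) (B ∷ []) _ (List.map (orient B) us)
        (λ { zero zero → norm })
        (λ { zero → All.map⁺ (All.map (λ {u} → orient-base B u) base) })
        -- `orient-Rel` changes only the left member of a pair; symmetry brings the right one there
        -- as well.
        (AllPairs.map⁺ (AllPairs.map (λ {u} {v} rel →
          orient-Rel B u (orient B v) (RelPair-sym {orient B v} {u} (orient-Rel B v u (RelPair-sym {u} {v} rel)))) pairs))
        (All.map⁺ (All.map (λ {u} → orient-Norm B u) norms))
        (subst (λ ts → T (refutedFrom ts)) (sym (trans (sym (List.map-∘ us)) types)) ref)

-- By hand: a triple of the first type has determinant 4 or 0, a pair of the second has 3. If some
-- triple has 4, it gives 12 together with the pair. Otherwise the block of four has determinant
-- -27, and one more matrix gives -54.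
refuted-4-2 : refutedFrom (replicate 3 true ++ replicate 2 false) ≡ true
refuted-4-2 = refl

-- By hand: any four of the five, together with the orthogonal matrix, give 10, -6 or -54, and only
-- 10 is inconclusive. If it occurs for every four, all signs can be made positive, and the five
-- have determinant 6.
refuted-5-1 : refutedFrom (replicate 4 true ++ replicate 1 false) ≡ true
refuted-5-1 = refl

-- Up to negating matrices there are seven 5×5 patterns, of determinants 6, -6, -10, -18, -54, -162
-- and 2. Only -10 is inconclusive, and the evaluation shows that it cannot occur for every five of
-- seven matrices.
refuted-7-0 : refutedFrom (replicate 6 true ++ replicate 0 false) ≡ true
refuted-7-0 = refl

-- A total of seven always contains an excluded pattern: 6 + 1 and 5 + 2 contain 5 + 1, and 4 + 3
-- contains 4 + 2.
at-most-six : ∀ a b →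
  ¬ (4 ≤ a × 2 ≤ b) → ¬ (5 ≤ a × 1 ≤ b) → ¬ (7 ≤ a × 0 ≤ b) →
  ¬ (4 ≤ b × 2 ≤ a) → ¬ (5 ≤ b × 1 ≤ a) → ¬ (7 ≤ b × 0 ≤ a) → a ℕ.+ b ≤ 6
at-most-six 0 b _ _ _ _ _ ¬07 = ℕ.≮⇒≥ λ 7≤b → ¬07 (7≤b , z≤n)
at-most-six 1 b _ _ _ _ ¬15 _ = ℕ.+-monoʳ-≤ 1 {b} {5} (ℕ.m≤n⇒m≤1+n (ℕ.≮⇒≥ λ 5≤b → ¬15 (5≤b , s≤s z≤n)))
at-most-six 2 b _ _ _ ¬24 _ _ = ℕ.+-monoʳ-≤ 2 {b} {4} (ℕ.m≤n⇒m≤1+n (ℕ.≮⇒≥ λ 4≤b → ¬24 (4≤b , s≤s (s≤s z≤n))))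
at-most-six 3 b _ _ _ ¬24 _ _ = ℕ.+-monoʳ-≤ 3 (ℕ.≮⇒≥ λ 4≤b → ¬24 (4≤b , s≤s (s≤s z≤n)))
at-most-six 4 b ¬42 _ _ _ _ _ = ℕ.+-monoʳ-≤ 4 {b} {2} (ℕ.m≤n⇒m≤1+n (ℕ.≮⇒≥ λ 2≤b → ¬42 (s≤s (s≤s (s≤s (s≤s z≤n))) , 2≤b)))
at-most-six 5 b _ ¬51 _ _ _ _ = ℕ.+-monoʳ-≤ 5 {b} {1} (ℕ.m≤n⇒m≤1+n (ℕ.≮⇒≥ λ 1≤b → ¬51 (s≤s (s≤s (s≤s (s≤s (s≤s z≤n)))) , 1≤b)))
at-most-six 6 b _ ¬51 _ _ _ _ = ℕ.+-monoʳ-≤ 6 {b} {0} (ℕ.≮⇒≥ λ 1≤b → ¬51 (s≤s (s≤s (s≤s (s≤s (s≤s z≤n)))) , 1≤b))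
at-most-six (suc (suc (suc (suc (suc (suc (suc a))))))) b _ _ ¬70 _ _ _ =
  ⊥-elim (¬70 (s≤s (s≤s (s≤s (s≤s (s≤s (s≤s (s≤s z≤n)))))) , z≤n))

map-const-take : ∀ {A B : Set} (t : B) n (xs : List A) → n ≤ length xs →
  List.map proj₁ (List.map (t ,_) (take n xs)) ≡ replicate n t
map-const-take t zero    xs       z≤n       = refl
map-const-take t (suc n) (x ∷ xs) (s≤s n≤m) = cong (t ∷_) (map-const-take t n xs n≤m)

-- The bound six for two mutually orthogonal families.

module FamilyBound {q : ℕ} (F : FiniteField q) (N≢0 : FieldFacts.ι F N ≢ FiniteField.0F F) where
  open FieldFacts F
  open LinearAlgebra F
  open Families F N≢0

  Proportional : Fin q → M2 q → M2 q → Set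
  Proportional d A B = (⟪ A , B ⟫ ≡ d) ⊎ (⟪ A , B ⟫ ≡ - d)

  Family : Fin q → List (M2 q) → Set
  Family d As = AllPairs (Proportional d) As × All (λ A → det F A ≡ d) As

  Orthogonal : List (M2 q) → List (M2 q) → Set
  Orthogonal As Bs = All (λ A → All (λ B → ⟪ A , B ⟫ ≡ 0#) Bs) As

  ⟪A,A⟫≡2det : ∀ A → ⟪ A , A ⟫ ≡ ι (pos 2) * det F A
  ⟪A,A⟫≡2det (mat a b c d) = solve 4 (λ a b c d → (a :* d :+ d :* a) :- (b :* c :+ c :* b) := con (pos 2) :* (a :* d :- b :* c)) refl a b c d

  module _ {d e : Fin q} (d≢0 : d ≢ 0#) (e≢0 : e ≢ 0#) where

    weight : Bool → Fin q
    weight t = if t then d else e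

    weight≢0 : ∀ t → weight t ≢ 0#
    weight≢0 true  = d≢0
    weight≢0 false = e≢0

    open Typed weight weight≢0

    RelPair-proportional : ∀ t {A B} → Proportional (weight t) A B → RelPair (t , A) (t , B)
    RelPair-proportional t {A} {B} (inj₁ p) = 1ℤ , plus t ,
      trans (⟪⟫-sym B A) (trans p (solve 1 (λ x → x := con 1ℤ :* x) refl (weight t)))
      where
      plus : ∀ t → 1ℤ ∈ entries (false , t) t
      plus true  = here refl
      plus false = here refl
    RelPair-proportional t {A} {B} (inj₂ p) = -1ℤ , minus t ,
      trans (⟪⟫-sym B A) (trans p (solve 1 (λ x → :- x := con -1ℤ :* x) refl (weight t)))
      where
      minus : ∀ t → -1ℤ ∈ entries (false , t) t
      minus true  = there (here refl)
      minus false = there (here refl)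

    RelPair-orthogonal : ∀ {A B} → ⟪ A , B ⟫ ≡ 0# → RelPair (true , A) (false , B)
    RelPair-orthogonal {A} {B} p = 0ℤ , here refl , trans (⟪⟫-sym B A) (trans p (sym (zeroˡ d)))

    Norm-det : ∀ t {A} → det F A ≡ weight t → Norm (t , A)
    Norm-det t {A} detA = trans (⟪A,A⟫≡2det A) (cong (ι (pos 2) *_) detA)

    -- The head of `As` becomes the base matrix, whence `suc a`. The weights d and e are arbitrary,
    -- so the mirrored patterns are obtained by exchanging the families.
    excluded : ∀ a b → refutedFrom (replicate a true ++ replicate b false) ≡ true →
      ∀ {As Bs} → Family d As → Family e Bs → Orthogonal As Bs → ¬ (suc a ≤ length As × b ≤ length Bs)
    excluded a b ref {A ∷ As} {Bs} (pA ∷ psA , nA ∷ nsA) (psB , nsB) (oA ∷ os) (s≤s a≤ , b≤) =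
      refutedFrom-absurd A (tagged true a As ++ tagged false b Bs) (replicate a true ++ replicate b false)
        (trans (List.map-++ proj₁ (tagged true a As) (tagged false b Bs))
               (cong₂ _++_ (map-const-take true a As a≤) (map-const-take false b Bs b≤)))
        (Norm-det true {A} nA)
        (All.++⁺ (All.map⁺ (All.take⁺ a (All.map (λ {B} → RelPair-proportional true {A} {B}) pA)))
                 (All.map⁺ (All.take⁺ b (All.map (λ {B} → RelPair-orthogonal {A} {B}) oA))))
        (AllPairs.++⁺
          (AllPairs.map⁺ (AllPairs.take⁺ a (AllPairs.map (λ {A} {B} → RelPair-proportional true {A} {B}) psA)))
          (AllPairs.map⁺ (AllPairs.take⁺ b (AllPairs.map (λ {A} {B} → RelPair-proportional false {A} {B}) psB)))
          (All.map⁺ (All.take⁺ a (All.map (λ {A} o →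
            All.map⁺ (All.take⁺ b (All.map (λ {B} → RelPair-orthogonal {A} {B}) o))) os))))
        (All.++⁺ (All.map⁺ (All.take⁺ a (All.map (λ {A} → Norm-det true {A}) nsA)))
                 (All.map⁺ (All.take⁺ b (All.map (λ {A} → Norm-det false {A}) nsB))))
        (Equivalence.from Bool.T-≡ ref)
      where
      tagged : Bool → ℕ → List (M2 q) → List (Bool × M2 q)
      tagged t k Cs = List.map (t ,_) (take k Cs)

  Orthogonal-sym : ∀ {As Bs} → Orthogonal As Bs → Orthogonal Bs As
  Orthogonal-sym {As} {[]}     orth = []
  Orthogonal-sym {As} {B ∷ Bs} orth =
    All.map (λ {A} o → trans (⟪⟫-sym B A) (All.head o)) orth ∷ Orthogonal-sym (All.map All.tail orth)

  family-bound : ∀ {d e} → d ≢ 0# → e ≢ 0# → ∀ {As Bs} → Family d As → Family e Bs → Orthogonal As Bs →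
    length As ℕ.+ length Bs ≤ 6
  family-bound d≢0 e≢0 {As} {Bs} famA famB orth = at-most-six (length As) (length Bs)
    (excluded d≢0 e≢0 3 2 refuted-4-2 famA famB orth)
    (excluded d≢0 e≢0 4 1 refuted-5-1 famA famB orth)
    (excluded d≢0 e≢0 6 0 refuted-7-0 famA famB orth)
    (excluded e≢0 d≢0 3 2 refuted-4-2 famB famA (Orthogonal-sym orth))
    (excluded e≢0 d≢0 4 1 refuted-5-1 famB famA (Orthogonal-sym orth))
    (excluded e≢0 d≢0 6 0 refuted-7-0 famB famA (Orthogonal-sym orth))

-- Trace, determinant and powers of 2×2 matrices.

module MatrixGroup {q : ℕ} (F : FiniteField q) where
  open FieldFacts F
  open LinearAlgebra F using (⟪_,_⟫)
  open ≡-Reasoning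

  infixl 7 _·_
  _·_ : M2 q → M2 q → M2 q
  _·_ = _·M_ F

  mat-cong : ∀ {a b c d a' b' c' d' : Fin q} → a ≡ a' → b ≡ b' → c ≡ c' → d ≡ d' → mat a b c d ≡ mat a' b' c' d'
  mat-cong refl refl refl refl = refl

  adj : M2 q → M2 q
  adj (mat a b c d) = mat d (- b) (- c) a

  tr : M2 q → Fin q
  tr (mat a b c d) = a + d

  scalar : Fin q → M2 q
  scalar x = mat x 0# 0# x

  scalar-Scalar : ∀ {x} → x ≢ 0# → Scalar F (scalar x)
  scalar-Scalar x≢0 = refl , refl , refl , x≢0

  det-· : ∀ A B → det F (A · B) ≡ det F A * det F B
  det-· (mat a b c d) (mat a' b' c' d') =
    solve 8 (λ a b c d a' b' c' d' →
        (a :* a' :+ b :* c') :* (c :* b' :+ d :* d') :- (a :* b' :+ b :* d') :* (c :* a' :+ d :* c') :=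
        (a :* d :- b :* c) :* (a' :* d' :- b' :* c'))
      refl a b c d a' b' c' d'

  det-adj : ∀ A → det F (adj A) ≡ det F A
  det-adj (mat a b c d) =
    solve 4 (λ a b c d → d :* a :- (:- b) :* (:- c) := a :* d :- b :* c) refl a b c d

  det-scalar : ∀ x → det F (scalar x) ≡ x * x
  det-scalar x = solve 1 (λ x → x :* x :- con 0ℤ :* con 0ℤ := x :* x) refl x

  tr-adj-· : ∀ A B → tr (adj A · B) ≡ ⟪ A , B ⟫
  tr-adj-· (mat a b c d) (mat a' b' c' d') =
    solve 8 (λ a b c d a' b' c' d' →
        (d :* a' :+ (:- b) :* c') :+ ((:- c) :* b' :+ a :* d') := (a :* d' :+ d :* a') :- (b :* c' :+ c :* b'))
      refl a b c d a' b' c' d'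

  adj-· : ∀ A → adj A · A ≡ scalar (det F A)
  adj-· (mat a b c d) = mat-cong
    (solve 4 (λ a b c d → d :* a :+ (:- b) :* c := a :* d :- b :* c) refl a b c d)
    (solve 2 (λ b d → d :* b :+ (:- b) :* d := con 0ℤ) refl b d)
    (solve 2 (λ a c → (:- c) :* a :+ a :* c := con 0ℤ) refl a c)
    (solve 4 (λ a b c d → (:- c) :* b :+ a :* d := a :* d :- b :* c) refl a b c d)

  ·-adj : ∀ A → A · adj A ≡ scalar (det F A)
  ·-adj (mat a b c d) = mat-cong
    (solve 4 (λ a b c d → a :* d :+ b :* (:- c) := a :* d :- b :* c) refl a b c d)
    (solve 2 (λ a b → a :* (:- b) :+ b :* a := con 0ℤ) refl a b)
    (solve 2 (λ c d → c :* d :+ d :* (:- c) := con 0ℤ) refl c d)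
    (solve 4 (λ a b c d → c :* (:- b) :+ d :* a := a :* d :- b :* c) refl a b c d)

  -- By Cayley-Hamilton a power of A is x A plus a scalar matrix; if the power is scalar, so is x A.
  -- The lemma removes the factor x.
  multiple-scalar : ∀ {x} A → x ≢ 0# → InGL F A → x * M2.b A ≡ 0# → x * M2.c A ≡ 0# →
    x * M2.a A ≡ x * M2.d A → Scalar F A
  multiple-scalar (mat a b c d) x≢0 det≢0 xb≡0 xc≡0 xa≡xd
    with refl ← *-integral xb≡0 x≢0 | refl ← *-integral xc≡0 x≢0 | refl ← *-cancelˡ x≢0 xa≡xd =
    refl , refl , refl , λ { refl → det≢0 (solve 0 (con 0ℤ :* con 0ℤ :- con 0ℤ :* con 0ℤ := con 0ℤ) refl) }

  private
    equate : ∀ {x y z w} → x + - y ≡ z + - w → z ≡ w → x ≡ y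
    equate {z = z} eq refl = x-y≡0⇒x≡y (trans eq (-‿inverseʳ z))

  -- Since A² = tr · A - det, a nonzero trace would make A itself scalar.
  scalar-square : ∀ A → InGL F A → ¬ Scalar F A → Scalar F (A · A) → tr A ≡ 0#
  scalar-square A@(mat a b c d) det≢0 ¬scalar (B≡0 , C≡0 , A≡D , _) with tr A Fin.≟ 0#
  ... | yes tr≡0 = tr≡0
  ... | no  tr≢0 = ⊥-elim (¬scalar (multiple-scalar A tr≢0 det≢0
    (trans (solve 3 (λ a b d → (a :+ d) :* b := a :* b :+ b :* d) refl a b d) B≡0)
    (trans (solve 3 (λ a c d → (a :+ d) :* c := c :* a :+ d :* c) refl a c d) C≡0)
    (equate (solve 4 (λ a b c d → (a :+ d) :* a :- (a :+ d) :* d := (a :* a :+ b :* c) :- (c :* b :+ d :* d))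
              refl a b c d) A≡D)))

  -- By Cayley–Hamilton, A³ = (tr² − det) A − tr · det.
  scalar-cube : ∀ A → InGL F A → ¬ Scalar F A → Scalar F (A · (A · A)) → tr A * tr A ≡ det F A
  scalar-cube A@(mat a b c d) det≢0 ¬scalar (B≡0 , C≡0 , A≡D , _) with (tr A * tr A + - det F A) Fin.≟ 0#
  ... | yes eq = x-y≡0⇒x≡y eq
  ... | no neq = ⊥-elim (¬scalar (multiple-scalar A neq det≢0
    (trans (solve 4 (λ a b c d → ((a :+ d) :* (a :+ d) :- (a :* d :- b :* c)) :* b :=
             a :* (a :* b :+ b :* d) :+ b :* (c :* b :+ d :* d)) refl a b c d) B≡0)
    (trans (solve 4 (λ a b c d → ((a :+ d) :* (a :+ d) :- (a :* d :- b :* c)) :* c :=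
             c :* (a :* a :+ b :* c) :+ d :* (c :* a :+ d :* c)) refl a b c d) C≡0)
    (equate (solve 4 (λ a b c d → ((a :+ d) :* (a :+ d) :- (a :* d :- b :* c)) :* a :- ((a :+ d) :* (a :+ d) :- (a :* d :- b :* c)) :* d :=
             (a :* (a :* a :+ b :* c) :+ b :* (c :* a :+ d :* c)) :- (c :* (a :* b :+ b :* d) :+ d :* (c :* b :+ d :* d)))
              refl a b c d) A≡D)))

  unit-multiple : ∀ A {s} → InGL F A → det F A ≡ s * s → ∃[ B ] InSL F B × s ≢ 0# × A ≡ scalar s · B
  unit-multiple (mat a b c d) {s} det≢0 det≡s² =
    let t , st≡1 = inverse s s≢0
    in mat (t * a) (t * b) (t * c) (t * d) ,
       (begin
          t * a * (t * d) + - (t * b * (t * c))   ≡⟨ solve 5 (λ t a b c d → t :* a :* (t :* d) :- t :* b :* (t :* c) := t :* t :* (a :* d :- b :* c)) refl t a b c d ⟩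
          t * t * (a * d + - (b * c))             ≡⟨ cong (t * t *_) det≡s² ⟩
          t * t * (s * s)                         ≡⟨ solve 2 (λ s t → t :* t :* (s :* s) := s :* t :* (s :* t)) refl s t ⟩
          s * t * (s * t)                         ≡⟨ cong₂ _*_ st≡1 st≡1 ⟩
          1# * 1#                                 ≡⟨ *-identityˡ 1# ⟩
          1#                                      ∎) ,
       s≢0 ,
       mat-cong (upper st≡1 a c) (upper st≡1 b d) (lower st≡1 a c) (lower st≡1 b d)
    where
    s≢0 : s ≢ 0#
    s≢0 refl = det≢0 (trans det≡s² (zeroˡ 0#))
    upper : ∀ {t} → s * t ≡ 1# → ∀ x y → x ≡ s * (t * x) + 0# * (t * y)
    upper {t} st≡1 x y = begin
      x                             ≡⟨ *-identityˡ x ⟨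
      1# * x                        ≡⟨ cong (_* x) st≡1 ⟨
      s * t * x                     ≡⟨ solve 4 (λ s t x y → s :* t :* x := s :* (t :* x) :+ con 0ℤ :* (t :* y)) refl s t x y ⟩
      s * (t * x) + 0# * (t * y)    ∎
    lower : ∀ {t} → s * t ≡ 1# → ∀ x y → y ≡ 0# * (t * x) + s * (t * y)
    lower {t} st≡1 x y = trans (upper st≡1 y x) (+-comm _ _)

-- Permutations of three points.

module _ (σ : Fin 3 → Fin 3) where

  HasFixedPoint Involutive Threefold : Set
  HasFixedPoint = ∃[ i ] σ i ≡ i
  Involutive    = ∀ j → σ (σ j) ≡ j
  Threefold     = ∀ j → σ (σ (σ j)) ≡ j

  reflection-or-rotation? : Dec ((HasFixedPoint × Involutive) ⊎ Threefold)
  reflection-or-rotation? =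
    (Fin.any? (λ i → σ i Fin.≟ i) ×-dec Fin.all? (λ j → σ (σ j) Fin.≟ j)) ⊎-dec Fin.all? (λ j → σ (σ (σ j)) Fin.≟ j)

triple : ∀ {A : Set} → A → A → A → Fin 3 → A
triple x y z = lookup (x ∷ y ∷ z ∷ [])

-- A permutation of three points is the identity, a transposition or a 3-cycle. The fixed point is
-- recorded because it will yield a fixed arc.
reflection-or-rotation : (σ : Fin 3 → Fin 3) → Injective _≡_ _≡_ σ →
  (HasFixedPoint σ × Involutive σ) ⊎ Threefold σ
reflection-or-rotation σ σ-inj = transfer (all-triples (σ zero) (σ (suc zero)) (σ (suc (suc zero)))
  (λ e → contradiction (σ-inj e) λ ()) (λ e → contradiction (σ-inj e) λ ()) (λ e → contradiction (σ-inj e) λ ()))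
  where
  all-triples : ∀ i j k → i ≢ j → i ≢ k → j ≢ k →
    (HasFixedPoint (triple i j k) × Involutive (triple i j k)) ⊎ Threefold (triple i j k)
  all-triples = from-yes (Fin.all? λ i → Fin.all? λ j → Fin.all? λ k →
    ¬? (i Fin.≟ j) →-dec (¬? (i Fin.≟ k) →-dec (¬? (j Fin.≟ k) →-dec reflection-or-rotation? (triple i j k))))
  -- The decision procedure runs over triples of values, so σ is compared with its table.
  τ : Fin 3 → Fin 3
  τ = triple (σ zero) (σ (suc zero)) (σ (suc (suc zero)))
  τ≗σ : τ ≗ σ
  τ≗σ zero             = refl
  τ≗σ (suc zero)       = refl
  τ≗σ (suc (suc zero)) = refl
  τ²≗σ² : ∀ j → τ (τ j) ≡ σ (σ j)
  τ²≗σ² j = trans (τ≗σ (τ j)) (cong σ (τ≗σ j))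
  transfer : (HasFixedPoint τ × Involutive τ) ⊎ Threefold τ → (HasFixedPoint σ × Involutive σ) ⊎ Threefold σ
  transfer (inj₁ ((i , τi≡i) , inv)) = inj₁ ((i , trans (sym (τ≗σ i)) τi≡i) , λ j → trans (sym (τ²≗σ² j)) (inv j))
  transfer (inj₂ rot) = inj₂ λ j → trans (sym (trans (τ≗σ (τ (τ j))) (cong σ (τ²≗σ² j)))) (rot j)

-- Numbering the second element among those different from the first leaves no gaps: for `Fin 3`
-- exactly 3 · 2 = 6 codes.
ordered-pair-injective : ∀ {m} {i i' j j' : Fin (suc m)} (i≢j : i ≢ j) (i'≢j' : i' ≢ j') →
  combine i (punchOut i≢j) ≡ combine i' (punchOut i'≢j') → i ≡ i' × j ≡ j'
ordered-pair-injective {i = i} {i'} i≢j i'≢j' eq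
  with Fin.combine-injective i (punchOut i≢j) i' (punchOut i'≢j') eq
... | refl , eq′ = refl , Fin.punchOut-injective i≢j i'≢j' eq′

lookup-distinct : ∀ {n} {L : List (Fin n → Fin n)} → Distinct L → ∀ i j → List.lookup L i ≗ List.lookup L j → i ≡ j
lookup-distinct (f∉ ∷ dist) zero    zero    eq = refl
lookup-distinct (f∉ ∷ dist) zero    (suc j) eq = contradiction eq (All.lookup f∉ (∈-lookup j))
lookup-distinct (f∉ ∷ dist) (suc i) zero    eq = contradiction (sym ∘ eq) (All.lookup f∉ (∈-lookup i))
lookup-distinct (f∉ ∷ dist) (suc i) (suc j) eq = cong suc (lookup-distinct dist i j eq)

-- Counting automorphisms by 2-arcs.

module CubicGraph {n : ℕ} (X : Graph n) (cubic : Cubic X) (regular : RegularOnTwoArcs X (IsAut X)) where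
  open Graph X using (Adj) renaming (sym to Adj-sym)

  Aut : (Fin n → Fin n) → Set
  Aut = IsAut X

  neighbours : ∀ v → ∃[ f ] (∀ i → Adj v (f i)) × (∀ {i j : Fin 3} → f i ≡ f j → i ≡ j) × (∀ {w} → Adj v w → ∃[ i ] w ≡ f i)
  neighbours v with cubic v
  ... | x , y , z , vx , vy , vz , x≢y , x≢z , y≢z , only = triple x y z , adj , inj , surj
    where
    adj : ∀ i → Adj v (triple x y z i)
    adj zero             = vx
    adj (suc zero)       = vy
    adj (suc (suc zero)) = vz
    inj : ∀ {i j} → triple x y z i ≡ triple x y z j → i ≡ j
    inj {zero}           {zero}           _ = refl
    inj {zero}           {suc zero}       e = contradiction e x≢y
    inj {zero}           {suc (suc zero)} e = contradiction e x≢z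
    inj {suc zero}       {zero}           e = contradiction (sym e) x≢y
    inj {suc zero}       {suc zero}       _ = refl
    inj {suc zero}       {suc (suc zero)} e = contradiction e y≢z
    inj {suc (suc zero)} {zero}           e = contradiction (sym e) x≢z
    inj {suc (suc zero)} {suc zero}       e = contradiction (sym e) y≢z
    inj {suc (suc zero)} {suc (suc zero)} _ = refl
    surj : ∀ {w} → Adj v w → ∃[ i ] w ≡ triple x y z i
    surj {w} vw with only w vw
    ... | inj₁ w≡x        = zero , w≡x
    ... | inj₂ (inj₁ w≡y) = suc zero , w≡y
    ... | inj₂ (inj₂ w≡z) = suc (suc zero) , w≡z

  nb : Fin n → Fin 3 → Fin n
  nb v = proj₁ (neighbours v)

  nb-adj : ∀ v i → Adj v (nb v i)
  nb-adj v = proj₁ (proj₂ (neighbours v))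

  nb-injective : ∀ v {i j} → nb v i ≡ nb v j → i ≡ j
  nb-injective v = proj₁ (proj₂ (proj₂ (neighbours v)))

  nb-surjective : ∀ v {w} → Adj v w → ∃[ i ] w ≡ nb v i
  nb-surjective v = proj₂ (proj₂ (proj₂ (neighbours v)))

  Aut-∘ : ∀ {f g} → Aut f → Aut g → Aut (f ∘ g)
  Aut-∘ (f-inj , f-adj) (g-inj , g-adj) =
    g-inj ∘ f-inj ,
    λ u v → (λ uv → proj₁ (f-adj _ _) (proj₁ (g-adj u v) uv)) , (λ fgu → proj₂ (g-adj u v) (proj₂ (f-adj _ _) fgu))

  Aut-id : Aut id
  Aut-id = id , λ u v → id , id

  Aut-adj : ∀ {f u v} → Aut f → Adj u v → Adj (f u) (f v)
  Aut-adj (_ , f-adj) = proj₁ (f-adj _ _)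

  twoArc : ∀ v {i j} → i ≢ j → TwoArc X
  twoArc v {i} {j} i≢j = (nb v i , v , nb v j) , Adj-sym (nb-adj v i) , nb-adj v j , i≢j ∘ nb-injective v

  image : ∀ {f} → Aut f → TwoArc X → TwoArc X
  image {f} f-aut ((u , v , w) , uv , vw , u≢w) =
    (f u , f v , f w) , Aut-adj f-aut uv , Aut-adj f-aut vw , u≢w ∘ proj₁ f-aut

  -- A vertex with two of its neighbours is a 2-arc, and regularity leaves one automorphism with a
  -- given image of it.
  Aut-determined : ∀ {f g} v {i j} → i ≢ j → Aut f → Aut g →
    f v ≡ g v → f (nb v i) ≡ g (nb v i) → f (nb v j) ≡ g (nb v j) → f ≗ g
  Aut-determined {f} {g} v i≢j f-aut g-aut eq eqᵢ eqⱼ =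
    proj₂ (regular (twoArc v i≢j) (image f-aut (twoArc v i≢j))) f g f-aut g-aut
      (refl , refl , refl) (sym eqᵢ , sym eq , sym eqⱼ)

  Aut-nb : ∀ {f} → Aut f → ∀ v i → ∃[ j ] f (nb v i) ≡ nb (f v) j
  Aut-nb {f} f-aut v i = nb-surjective (f v) (Aut-adj f-aut (nb-adj v i))

  Aut-nb-injective : ∀ {f v w i j} → Aut f → f (nb v i) ≡ w → f (nb v j) ≡ w → i ≡ j
  Aut-nb-injective f-aut eqᵢ eqⱼ = nb-injective _ (proj₁ f-aut (trans eqᵢ (sym eqⱼ)))

  first≢second : _≢_ {A = Fin 3} zero (suc zero)
  first≢second ()

  module Counting (v₀ : Fin n) where

    private
      slots : ∀ {f} (f-aut : Aut f) → proj₁ (Aut-nb f-aut v₀ zero) ≢ proj₁ (Aut-nb f-aut v₀ (suc zero))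
      slots {f} f-aut eq = contradiction
        (Aut-nb-injective f-aut (proj₂ (Aut-nb f-aut v₀ zero))
          (trans (proj₂ (Aut-nb f-aut v₀ (suc zero))) (cong (nb (f v₀)) (sym eq)))) first≢second

    -- Records the image of a fixed 2-arc with middle vertex `v₀`; the graph has n · 3 · 2 such
    -- images.
    code : ∀ {f} → Aut f → Fin (n ℕ.* 6)
    code {f} f-aut = combine (f v₀) (combine (proj₁ (Aut-nb f-aut v₀ zero)) (punchOut (slots f-aut)))

    code-injective : ∀ {f g} (f-aut : Aut f) (g-aut : Aut g) → code f-aut ≡ code g-aut → f ≗ g
    code-injective {f} {g} f-aut g-aut eq =
      let fv≡gv , eq′ = Fin.combine-injective (f v₀) _ (g v₀) _ eq
          i≡i' , j≡j' = ordered-pair-injective (slots f-aut) (slots g-aut) eq′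
      in Aut-determined v₀ first≢second f-aut g-aut fv≡gv
           (trans (proj₂ (Aut-nb f-aut v₀ zero)) (trans (cong₂ nb fv≡gv i≡i') (sym (proj₂ (Aut-nb g-aut v₀ zero)))))
           (trans (proj₂ (Aut-nb f-aut v₀ (suc zero))) (trans (cong₂ nb fv≡gv j≡j') (sym (proj₂ (Aut-nb g-aut v₀ (suc zero))))))

    Frame : (Fin n → Fin n) → Fin n → Fin 3 → Fin 2 → Set
    Frame f w i j = f v₀ ≡ w × f (nb v₀ zero) ≡ nb w i × f (nb v₀ (suc zero)) ≡ nb w (punchIn i j)

    Frame-unique : ∀ {f f' w i j w' i' j'} → f ≗ f' → Frame f w i j → Frame f' w' i' j' → w ≡ w' × i ≡ i' × j ≡ j'
    Frame-unique {f} {i = i} {j} {i' = i'} {j'} f≗f' (refl , eqᵢ , eqⱼ) (eq' , eqᵢ' , eqⱼ')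
      with refl ← trans (f≗f' v₀) eq'
      with refl ← nb-injective (f v₀) {i} {i'} (trans (sym eqᵢ) (trans (f≗f' _) eqᵢ')) =
      refl , refl , Fin.punchIn-injective i j j' (nb-injective (f v₀) (trans (sym eqⱼ) (trans (f≗f' _) eqⱼ')))

    atFrame : ∀ w i j → ∃[ f ] Aut f × Frame f w i j
    atFrame w i j =
      let (f , f-aut , eqᵢ , eq , eqⱼ) , _ = regular (twoArc v₀ first≢second) (twoArc w {i} {punchIn i j} (Fin.punchInᵢ≢i i j ∘ sym))
      in f , f-aut , eq , eqᵢ , eqⱼ

    atFrame-injective : ∀ w i j w' i' j' → proj₁ (atFrame w i j) ≗ proj₁ (atFrame w' i' j') → w ≡ w' × i ≡ i' × j ≡ j'
    atFrame-injective w i j w' i' j' f≗f' =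
      Frame-unique f≗f' (proj₂ (proj₂ (atFrame w i j))) (proj₂ (proj₂ (atFrame w' i' j')))

    decode : Fin (n ℕ.* 6) → ∃[ f ] Aut f
    decode x =
      let w , y = remQuot {n} 6 x
          i , j = remQuot {3} 2 y
          f , f-aut , _ = atFrame w i j
      in f , f-aut

    decode-injective : ∀ x x' → proj₁ (decode x) ≗ proj₁ (decode x') → x ≡ x'
    decode-injective x x' eq =
      let w , y = remQuot {n} 6 x
          w' , y' = remQuot {n} 6 x'
          i , j = remQuot {3} 2 y
          i' , j' = remQuot {3} 2 y'
          w≡ , i≡ , j≡ = atFrame-injective w i j w' i' j' eq
          y≡y' = trans (sym (Fin.combine-remQuot {3} 2 y)) (trans (cong₂ combine i≡ j≡) (Fin.combine-remQuot {3} 2 y'))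
      in trans (sym (Fin.combine-remQuot {n} 6 x)) (trans (cong₂ combine w≡ y≡y') (Fin.combine-remQuot {n} 6 x'))

    -- Injections in both directions suffice; `code` and `decode` need not be inverse to each other.
    length-enumeration : ∀ L → Enumerates Aut L → length L ≡ n ℕ.* 6
    length-enumeration L (all-aut , distinct , complete) = ℕ.≤-antisym
      (Fin.injective⇒≤ {f = λ k → code (aut k)}
        (λ {k} {k'} eq → lookup-distinct distinct k k' (code-injective (aut k) (aut k') eq)))
      (Fin.injective⇒≤ {f = position} λ {x} {x'} eq → decode-injective x x' (position-injective x x' eq))
      where
      aut : ∀ k → Aut (List.lookup L k)
      aut k = All.lookup all-aut (∈-lookup k)
      found : ∀ x → Any (proj₁ (decode x) ≗_) L
      found x = complete _ (proj₂ (decode x))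
      position : Fin (n ℕ.* 6) → Fin (length L)
      position x = Any.index (found x)
      position-injective : ∀ x x' → position x ≡ position x' → proj₁ (decode x) ≗ proj₁ (decode x')
      position-injective x x' eq v =
        trans (Any.lookup-index (found x) v)
          (trans (cong (λ k → List.lookup L k v) eq) (sym (Any.lookup-index (found x') v)))

    -- The members all fix `v₀`, so any two agree there. This family attains the maximum.
    stabilizer : ∃[ L ] IntersectingFamily Aut L × length L ≡ 6
    stabilizer = List.tabulate member ,
      (All.tabulate⁺ {f = member} (λ k → proj₁ (proj₂ (element k))) ,
       AllPairs.tabulate⁺ {f = member} (λ {k} {k'} k≢k' eq → k≢k' (member-injective k k' eq)) ,
       AllPairs.tabulate⁺ {f = member} (λ {k} {k'} _ → v₀ , trans (fixes k) (sym (fixes k')))) ,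
      List.length-tabulate member
      where
      element : (k : Fin 6) → _
      element k = atFrame v₀ (proj₁ (remQuot {3} 2 k)) (proj₂ (remQuot {3} 2 k))
      member : Fin 6 → Fin n → Fin n
      member k = proj₁ (element k)
      fixes : ∀ k → member k v₀ ≡ v₀
      fixes k = proj₁ (proj₂ (proj₂ (element k)))
      member-injective : ∀ k k' → member k ≗ member k' → k ≡ k'
      member-injective k k' eq =
        let _ , i≡ , j≡ = atFrame-injective v₀ _ _ v₀ _ _ eq
        in trans (sym (Fin.combine-remQuot {3} 2 k)) (trans (cong₂ combine i≡ j≡) (Fin.combine-remQuot {3} 2 k'))

    density-one : (∀ L → IntersectingFamily Aut L → length L ≤ 6) → IntersectionDensityOne Aut
    density-one bound L enum = (proj₁ stabilizer , proj₁ (proj₂ stabilizer) , attains) , upper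
      where
      6n≡length : 6 ℕ.* n ≡ length L
      6n≡length = trans (ℕ.*-comm 6 n) (sym (length-enumeration L enum))
      attains : length (proj₁ stabilizer) ℕ.* n ≡ length L
      attains = trans (cong (ℕ._* n) (proj₂ (proj₂ stabilizer))) 6n≡length
      upper : ∀ L' → IntersectingFamily Aut L' → length L' ℕ.* n ≤ length L
      upper L' fam = ℕ.≤-trans (ℕ.*-monoˡ-≤ n (bound L' fam)) (ℕ.≤-reflexive 6n≡length)

-- Automorphisms as matrices: traces and determinants.

module ProjectiveAction {q : ℕ} (F : FiniteField q) {n : ℕ} (X : Graph n) (cubic : Cubic X)
  (regular : RegularOnTwoArcs X (IsAut X))
  (ψ : M2 q → (Fin n → Fin n))
  (ψ-∘ : ∀ A B → InGL F A → InGL F B → ψ (_·M_ F A B) ≗ (ψ A ∘ ψ B))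
  (ψ-aut : ∀ A → InGL F A → IsAut X (ψ A))
  (ψ-onto : ∀ f → IsAut X f → ∃[ A ] (InGL F A × f ≗ ψ A))
  (ψ-kernel : ∀ A → InGL F A → (ψ A ≗ id → Scalar F A) × (Scalar F A → ψ A ≗ id))
  (special-regular : RegularOnArcs X (λ f → ∃[ A ] (InSL F A × f ≗ ψ A)))
  (v₀ : Fin n) where

  open FieldFacts F
  open LinearAlgebra F using (⟪_,_⟫)
  open MatrixGroup F
  open CubicGraph X cubic regular
  open Counting v₀ using (atFrame)
  open Graph X using (Adj)

  Special : (Fin n → Fin n) → Set
  Special f = ∃[ A ] (InSL F A × f ≗ ψ A)

  Square : Fin q → Set
  Square x = ∃[ s ] x ≡ s * s

  SL⇒GL : ∀ {A} → InSL F A → InGL F A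
  SL⇒GL det≡1 det≡0 = 1≢0 (trans (sym det≡1) det≡0)

  adj-GL : ∀ {A} → InGL F A → InGL F (adj A)
  adj-GL {A} det≢0 = det≢0 ∘ trans (sym (det-adj A))

  ·-GL : ∀ {A B} → InGL F A → InGL F B → InGL F (A · B)
  ·-GL {A} {B} A∈ B∈ = *-nonzero A∈ B∈ ∘ trans (sym (det-· A B))

  scalar-GL : ∀ {x} → x ≢ 0# → InGL F (scalar x)
  scalar-GL {x} x≢0 = *-nonzero x≢0 x≢0 ∘ trans (sym (det-scalar x))

  ψ-scalar : ∀ {x} → x ≢ 0# → ψ (scalar x) ≗ id
  ψ-scalar {x} x≢0 = proj₂ (ψ-kernel (scalar x) (scalar-GL x≢0)) (scalar-Scalar x≢0)

  ψ-adjˡ : ∀ {A} → InGL F A → ψ (adj A) ∘ ψ A ≗ id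
  ψ-adjˡ {A} A∈ x = trans (sym (ψ-∘ (adj A) A (adj-GL A∈) A∈ x))
    (trans (cong (λ M → ψ M x) (adj-· A)) (ψ-scalar A∈ x))

  ψ-adjʳ : ∀ {A} → InGL F A → ψ A ∘ ψ (adj A) ≗ id
  ψ-adjʳ {A} A∈ x = trans (sym (ψ-∘ A (adj A) A∈ (adj-GL A∈) x))
    (trans (cong (λ M → ψ M x) (·-adj A)) (ψ-scalar A∈ x))

  id-Special : Special id
  id-Special = scalar 1# , trans (det-scalar 1#) (*-identityˡ 1#) , sym ∘ ψ-scalar 1≢0

  -- Dividing by a square root of the determinant gives determinant 1, and scalars act trivially.
  square⇒Special : ∀ {A} → InGL F A → Square (det F A) → Special (ψ A)
  square⇒Special {A} A∈ (s , det≡s²) =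
    let B , B∈SL , s≢0 , A≡sB = unit-multiple A A∈ det≡s²
    in B , B∈SL , λ x → trans (cong (λ M → ψ M x) A≡sB)
         (trans (ψ-∘ (scalar s) B (scalar-GL s≢0) (SL⇒GL B∈SL) x) (ψ-scalar s≢0 (ψ B x)))

  arc-fixing-trivial : ∀ {f u v} → Special f → Adj u v → f u ≡ u → f v ≡ v → f ≗ id
  arc-fixing-trivial {f} {u} {v} f∈ uv fu≡u fv≡v =
    proj₂ (special-regular ((u , v) , uv) ((u , v) , uv)) f id f∈ id-Special (fu≡u , fv≡v) (refl , refl)

  -- An element of a point stabilizer acts on the three neighbours as a reflection or a rotation,
  -- so it has order dividing 2 or 3.
  fixing-trace : ∀ {C v} → InGL F C → ψ C v ≡ v → ¬ Scalar F C →
    (¬ Square (det F C) × tr C ≡ 0#) ⊎ (tr C * tr C ≡ det F C)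
  fixing-trace {C} {v} C∈ fix ¬scalar = conclude (reflection-or-rotation σ σ-injective)
    where
    h : Fin n → Fin n
    h = ψ C
    h-aut : Aut h
    h-aut = ψ-aut C C∈
    σ : Fin 3 → Fin 3
    σ i = proj₁ (Aut-nb h-aut v i)
    h-nb : ∀ i → h (nb v i) ≡ nb v (σ i)
    h-nb i = trans (proj₂ (Aut-nb h-aut v i)) (cong (λ w → nb w (σ i)) fix)
    σ-injective : ∀ {i j} → σ i ≡ σ j → i ≡ j
    σ-injective {i} {j} eq = Aut-nb-injective h-aut (h-nb i) (trans (h-nb j) (cong (nb v) (sym eq)))
    h²-nb : ∀ i → h (h (nb v i)) ≡ nb v (σ (σ i))
    h²-nb i = trans (cong h (h-nb i)) (h-nb (σ i))
    h³-nb : ∀ i → h (h (h (nb v i))) ≡ nb v (σ (σ (σ i)))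
    h³-nb i = trans (cong h (h²-nb i)) (h-nb (σ (σ i)))
    conclude : (HasFixedPoint σ × Involutive σ) ⊎ Threefold σ →
      (¬ Square (det F C) × tr C ≡ 0#) ⊎ (tr C * tr C ≡ det F C)
    conclude (inj₁ ((i , σi≡i) , inv)) = inj₁
      -- A reflection fixes v and a neighbour, hence an arc. A square determinant would put it into
      -- PSL(2,q), where only the identity fixes an arc.
      ( (λ sq → ¬scalar (proj₁ (ψ-kernel C C∈)
          (arc-fixing-trivial (square⇒Special C∈ sq) (nb-adj v i) fix (trans (h-nb i) (cong (nb v) σi≡i)))))
      , scalar-square C C∈ ¬scalar (proj₁ (ψ-kernel (C · C) (·-GL {C} {C} C∈ C∈)) λ x → trans (ψ-∘ C C C∈ C∈ x) (h²≗id x)))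
      where
      h²≗id : h ∘ h ≗ id
      h²≗id = Aut-determined v first≢second (Aut-∘ h-aut h-aut) Aut-id
        (trans (cong h fix) fix) (fixes zero) (fixes (suc zero))
        where
        fixes : ∀ j → h (h (nb v j)) ≡ nb v j
        fixes j = trans (h²-nb j) (cong (nb v) (inv j))
    conclude (inj₂ rot) = inj₂ (scalar-cube C C∈ ¬scalar
      (proj₁ (ψ-kernel (C · (C · C)) (·-GL {C} {C · C} C∈ C²∈))
        λ x → trans (ψ-∘ C (C · C) C∈ C²∈ x) (trans (cong h (ψ-∘ C C C∈ C∈ x)) (h³≗id x))))
      where
      C²∈ : InGL F (C · C)
      C²∈ = ·-GL {C} {C} C∈ C∈
      h³≗id : h ∘ h ∘ h ≗ id
      h³≗id = Aut-determined v first≢second (Aut-∘ h-aut (Aut-∘ h-aut h-aut)) Aut-id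
        (trans (cong h (trans (cong h fix) fix)) fix)
        (fixes zero) (fixes (suc zero))
        where
        fixes : ∀ j → h (h (h (nb v j))) ≡ nb v j
        fixes j = trans (h³-nb j) (cong (nb v) (rot j))

  Meets : (Fin n → Fin n) → (Fin n → Fin n) → Set
  Meets f g = (¬ f ≗ g) × ∃[ v ] f v ≡ g v

  -- The matrix `adj A · B` acts as f⁻¹ g, which fixes every vertex where f and g agree. Its trace
  -- is ⟪ A , B ⟫ and its determinant is det A · det B.
  meeting-pairing : ∀ {f g A B} → f ≗ ψ A → g ≗ ψ B → InGL F A → InGL F B → Meets f g →
    (¬ Square (det F A * det F B) × ⟪ A , B ⟫ ≡ 0#) ⊎ (⟪ A , B ⟫ * ⟪ A , B ⟫ ≡ det F A * det F B)
  meeting-pairing {f} {g} {A} {B} f≗ g≗ A∈ B∈ (f≇g , v , fv≡gv) =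
      subst₂ (λ t d → (¬ Square d × t ≡ 0#) ⊎ (t * t ≡ d)) (tr-adj-· A B)
        (trans (det-· (adj A) B) (cong (_* det F B) (det-adj A)))
        (fixing-trace {adj A · B} {v} C∈ fixed ¬scalar)
    where
    C∈ : InGL F (adj A · B)
    C∈ = ·-GL {adj A} {B} (adj-GL {A} A∈) B∈
    ψC : ψ (adj A · B) ≗ ψ (adj A) ∘ g
    ψC x = trans (ψ-∘ (adj A) B (adj-GL {A} A∈) B∈ x) (cong (ψ (adj A)) (sym (g≗ x)))
    back : ψ (adj A) ∘ f ≗ id
    back x = trans (cong (ψ (adj A)) (f≗ x)) (ψ-adjˡ A∈ x)
    fixed : ψ (adj A · B) v ≡ v
    fixed = trans (ψC v) (trans (cong (ψ (adj A)) (sym fv≡gv)) (back v))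
    ¬scalar : ¬ Scalar F (adj A · B)
    ¬scalar sc = f≇g λ x → proj₁ (ψ-aut (adj A) (adj-GL {A} A∈))
      (trans (back x) (sym (trans (sym (ψC x)) (proj₂ (ψ-kernel _ C∈) sc x))))
  -- The identity and the flip are the stabilizer of an arc, so Aut(X) = PSL(2,q) ∪ PSL(2,q) · flip.
  flip : ∃[ f ] Aut f × (f v₀ ≡ v₀ × f (nb v₀ zero) ≡ nb v₀ zero × f (nb v₀ (suc zero)) ≡ nb v₀ (suc (suc zero)))
  flip = atFrame v₀ zero (suc zero)

  flip-matrix : M2 q
  flip-matrix = proj₁ (ψ-onto (proj₁ flip) (proj₁ (proj₂ flip)))

  flip-GL : InGL F flip-matrix
  flip-GL = proj₁ (proj₂ (ψ-onto (proj₁ flip) (proj₁ (proj₂ flip))))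

  flip≗ψ : proj₁ flip ≗ ψ flip-matrix
  flip≗ψ = proj₂ (proj₂ (ψ-onto (proj₁ flip) (proj₁ (proj₂ flip))))

  ε : Fin q
  ε = det F flip-matrix

  -- With a square determinant the flip would lie in PSL(2,q) and fix an arc, yet it moves a
  -- neighbour of `v₀`.
  ε-nonsquare : ¬ Square ε
  ε-nonsquare sq =
    let t , t-aut , tv , t₀ , t₁ = flip
        t≗id = arc-fixing-trivial (square⇒Special flip-GL sq) (nb-adj v₀ zero)
                 (trans (sym (flip≗ψ v₀)) tv) (trans (sym (flip≗ψ (nb v₀ zero))) t₀)
        nb₁ = nb v₀ (suc zero)
    in contradiction (nb-injective v₀ {suc zero} {suc (suc zero)} (trans (sym (trans (flip≗ψ nb₁) (t≗id nb₁))) t₁)) λ ()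

  Represented : Fin q → (Fin n → Fin n) → M2 q → Set
  Represented d f A = det F A ≡ d × f ≗ ψ A

  -- Some element of PSL(2,q) agrees with f on a fixed arc; correcting f by it leaves the identity
  -- or the flip. Determinants equal to 1 or ε, not merely modulo squares, are what gives pairings
  -- ±1 and ±ε.
  representation : ∀ {f} → Aut f → (∃[ A ] Represented 1# f A) ⊎ (∃[ A ] Represented ε f A)
  representation {f} f-aut = conclude (Aut-nb h-aut v₀ (suc zero))
    where
    g : ∃[ g ] Special g × (g v₀ ≡ f v₀) × (g (nb v₀ zero) ≡ f (nb v₀ zero))
    g = proj₁ (special-regular ((v₀ , nb v₀ zero) , nb-adj v₀ zero)
                 ((f v₀ , f (nb v₀ zero)) , Aut-adj f-aut (nb-adj v₀ zero)))
    A : M2 q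
    A = proj₁ (proj₁ (proj₂ g))
    A∈SL : InSL F A
    A∈SL = proj₁ (proj₂ (proj₁ (proj₂ g)))
    A∈ : InGL F A
    A∈ = SL⇒GL {A} A∈SL
    g≗ : proj₁ g ≗ ψ A
    g≗ = proj₂ (proj₂ (proj₁ (proj₂ g)))
    h : Fin n → Fin n
    h = ψ (adj A) ∘ f
    h-aut : Aut h
    h-aut = Aut-∘ (ψ-aut (adj A) (adj-GL {A} A∈)) f-aut
    h-fixes : ∀ {x} → proj₁ g x ≡ f x → h x ≡ x
    h-fixes {x} gx≡fx = trans (cong (ψ (adj A)) (trans (sym gx≡fx) (g≗ x))) (ψ-adjˡ A∈ x)
    h-v₀ : h v₀ ≡ v₀
    h-v₀ = h-fixes (proj₁ (proj₂ (proj₂ g)))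
    h-nb₀ : h (nb v₀ zero) ≡ nb v₀ zero
    h-nb₀ = h-fixes (proj₂ (proj₂ (proj₂ g)))
    f≗ψA∘h : f ≗ ψ A ∘ h
    f≗ψA∘h x = sym (ψ-adjʳ A∈ (f x))
    conclude : ∃[ j ] h (nb v₀ (suc zero)) ≡ nb (h v₀) j → (∃[ A ] Represented 1# f A) ⊎ (∃[ A ] Represented ε f A)
    conclude (zero , eq) = contradiction
      (Aut-nb-injective h-aut h-nb₀ (trans eq (cong (λ w → nb w zero) h-v₀))) first≢second
    conclude (suc zero , eq) = inj₁ (A , A∈SL , λ x → trans (f≗ψA∘h x) (cong (ψ A) (h≗id x)))
      where
      h≗id : h ≗ id
      h≗id = Aut-determined v₀ first≢second h-aut Aut-id h-v₀ h-nb₀ (trans eq (cong (λ w → nb w (suc zero)) h-v₀))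
    conclude (suc (suc zero) , eq) = inj₂ (A · flip-matrix ,
      trans (det-· A flip-matrix) (trans (cong (_* ε) A∈SL) (*-identityˡ ε)) ,
      λ x → trans (f≗ψA∘h x) (trans (cong (ψ A) (trans (h≗flip x) (flip≗ψ x))) (sym (ψ-∘ A flip-matrix A∈ flip-GL x))))
      where
      h≗flip : h ≗ proj₁ flip
      h≗flip = let t , t-aut , tv , t₀ , t₁ = flip in
        Aut-determined v₀ first≢second h-aut t-aut (trans h-v₀ (sym tv)) (trans h-nb₀ (sym t₀))
          (trans eq (trans (cong (λ w → nb w (suc (suc zero))) h-v₀) (sym t₁)))

-- Splitting an intersecting family by determinant.

module IntersectingFamilies {q : ℕ} (F : FiniteField q) (N≢0 : FieldFacts.ι F N ≢ FiniteField.0F F)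
  {n : ℕ} (X : Graph n) (cubic : Cubic X) (regular : RegularOnTwoArcs X (IsAut X))
  (ψ : M2 q → (Fin n → Fin n))
  (ψ-∘ : ∀ A B → InGL F A → InGL F B → ψ (_·M_ F A B) ≗ (ψ A ∘ ψ B))
  (ψ-aut : ∀ A → InGL F A → IsAut X (ψ A))
  (ψ-onto : ∀ f → IsAut X f → ∃[ A ] (InGL F A × f ≗ ψ A))
  (ψ-kernel : ∀ A → InGL F A → (ψ A ≗ id → Scalar F A) × (Scalar F A → ψ A ≗ id))
  (special-regular : RegularOnArcs X (λ f → ∃[ A ] (InSL F A × f ≗ ψ A)))
  (v₀ : Fin n) where

  open FieldFacts F
  open LinearAlgebra F using (⟪_,_⟫)
  open Families F N≢0 using (⟪⟫-sym)
  open FamilyBound F N≢0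
  open CubicGraph X cubic regular using (Aut)
  open ProjectiveAction F X cubic regular ψ ψ-∘ ψ-aut ψ-onto ψ-kernel special-regular v₀

  -- Ties a matrix to an automorphism of the list, so that `Meets` can be carried over to matrices.
  Source : Fin q → List (Fin n → Fin n) → M2 q → Set
  Source d fs A = det F A ≡ d × Any (_≗ ψ A) fs

  Source-∷ : ∀ {d f fs As} → All (Source d fs) As → All (Source d (f ∷ fs)) As
  Source-∷ = All.map λ (det≡d , src) → det≡d , there src

  det⇒GL : ∀ {d A} → d ≢ 0# → det F A ≡ d → InGL F A
  det⇒GL d≢0 det≡d det≡0 = d≢0 (trans (sym det≡d) det≡0)

  module _ {d e f fs A} (d≢0 : d ≢ 0#) (e≢0 : e ≢ 0#) (rep : Represented d f A) (meets : All (Meets f) fs) where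

    source-pairing : ∀ {B} → Source e fs B →
      (¬ Square (d * e) × ⟪ A , B ⟫ ≡ 0#) ⊎ (⟪ A , B ⟫ * ⟪ A , B ⟫ ≡ d * e)
    source-pairing {B} (det≡e , src) =
      let meet , g≗ = All.lookupAny meets src
      in subst (λ x → (¬ Square x × ⟪ A , B ⟫ ≡ 0#) ⊎ (⟪ A , B ⟫ * ⟪ A , B ⟫ ≡ x))
           (cong₂ _*_ (proj₁ rep) det≡e)
           (meeting-pairing {A = A} {B} (proj₂ rep) g≗ (det⇒GL {d} {A} d≢0 (proj₁ rep)) (det⇒GL {e} {B} e≢0 det≡e) meet)

    -- The rotation case would exhibit d e as the square of ⟪ A , B ⟫.
    orthogonal-to : ¬ Square (d * e) → ∀ {Bs} → All (Source e fs) Bs → All (λ B → ⟪ A , B ⟫ ≡ 0#) Bs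
    orthogonal-to nonsquare = All.map λ {B} src →
      [ proj₂ , (λ eq → contradiction (⟪ A , B ⟫ , sym eq) nonsquare) ] (source-pairing {B} src)

  -- The product of the determinants is the square d², so the reflection case is impossible and the
  -- pairing is a square root of d².
  proportional-to : ∀ {d f fs A} → d ≢ 0# → Represented d f A → All (Meets f) fs →
    ∀ {Bs} → All (Source d fs) Bs → All (Proportional d A) Bs
  proportional-to {d} {A = A} d≢0 rep meets = All.map λ {B} src →
    [ (λ (nonsquare , _) → contradiction (d , refl) nonsquare) , square-roots ]
      (source-pairing {A = A} d≢0 d≢0 rep meets {B} src)

  ε≢0 : ε ≢ 0#
  ε≢0 = flip-GL

  record Splitting (fs : List (Fin n → Fin n)) : Set where
    field
      inner outer  : List (M2 q)
      inner-family : Family 1# inner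
      outer-family : Family ε outer
      orthogonal   : Orthogonal inner outer
      inner-source : All (Source 1# fs) inner
      outer-source : All (Source ε fs) outer
      lengths      : length inner ℕ.+ length outer ≡ length fs

  module _ {f fs} (meets : All (Meets f) fs) (S : Splitting fs) where
    open Splitting S

    insert-inner : ∀ A → Represented 1# f A → Splitting (f ∷ fs)
    insert-inner A rep = record
      { inner        = A ∷ inner
      ; outer        = outer
      ; inner-family = proportional-to {A = A} 1≢0 rep meets inner-source ∷ proj₁ inner-family , proj₁ rep ∷ proj₂ inner-family
      ; outer-family = outer-family
      ; orthogonal   = orthogonal-to {A = A} 1≢0 ε≢0 rep meets 1ε-nonsquare outer-source ∷ orthogonal
      ; inner-source = (proj₁ rep , here (proj₂ rep)) ∷ Source-∷ inner-source
      ; outer-source = Source-∷ outer-source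
      ; lengths      = cong suc lengths
      }
      where
      1ε-nonsquare : ¬ Square (1# * ε)
      1ε-nonsquare sq = ε-nonsquare (subst Square (*-identityˡ ε) sq)

    insert-outer : ∀ B → Represented ε f B → Splitting (f ∷ fs)
    insert-outer B rep = record
      { inner        = inner
      ; outer        = B ∷ outer
      ; inner-family = inner-family
      ; outer-family = proportional-to {A = B} ε≢0 rep meets outer-source ∷ proj₁ outer-family , proj₁ rep ∷ proj₂ outer-family
      ; orthogonal   = Orthogonal-sym
          (orthogonal-to {A = B} ε≢0 1≢0 rep meets ε1-nonsquare inner-source ∷ Orthogonal-sym orthogonal)
      ; inner-source = Source-∷ inner-source
      ; outer-source = (proj₁ rep , here (proj₂ rep)) ∷ Source-∷ outer-source
      ; lengths      = trans (ℕ.+-suc (length inner) (length outer)) (cong suc lengths)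
      }
      where
      ε1-nonsquare : ¬ Square (ε * 1#)
      ε1-nonsquare sq = ε-nonsquare (subst Square (*-identityʳ ε) sq)

  split : ∀ {fs} → All Aut fs → AllPairs Meets fs → Splitting fs
  split []             []              = record
    { inner = [] ; outer = [] ; inner-family = [] , [] ; outer-family = [] , [] ; orthogonal = []
    ; inner-source = [] ; outer-source = [] ; lengths = refl }
  split (f-aut ∷ auts) (meets ∷ pairs) =
    [ (λ (A , rep) → insert-inner meets (split auts pairs) A rep)
    , (λ (B , rep) → insert-outer meets (split auts pairs) B rep) ] (representation f-aut)

  intersecting-bound : ∀ fs → IntersectingFamily Aut fs → length fs ≤ 6
  intersecting-bound fs (auts , distinct , meet) =
    subst (_≤ 6) lengths (family-bound 1≢0 ε≢0 inner-family outer-family orthogonal)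
    where
    open Splitting (split auts (AllPairs.zip (distinct , meet)))

-- Invertibility of 324 and the conclusion.

prime-divides-power : ∀ {r p} k → Prime r → Prime p → r ∣ p ^ k → r ≡ p
prime-divides-power zero    r-prime p-prime r∣1 with refl ← ∣1⇒≡1 r∣1 = contradiction r-prime ¬prime[1]
prime-divides-power {r} {p} (suc k) r-prime p-prime r∣pᵏ⁺¹ with euclidsLemma p (p ^ k) r-prime r∣pᵏ⁺¹
... | inj₂ r∣pᵏ = prime-divides-power k r-prime p-prime r∣pᵏ
... | inj₁ r∣p with prime⇒irreducible p-prime r∣p
...   | inj₁ refl = contradiction r-prime ¬prime[1]
...   | inj₂ r≡p  = r≡p

module _ (p k : ℕ) (p-prime : Prime p) (p≢2 : p ≢ 2) (p≢3 : p ≢ 3) (F : FiniteField (p ^ k)) where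
  open FieldFacts F

  ι-N≢0 : ι N ≢ 0#
  ι-N≢0 = product (pos 4) (pos 81) (product (pos 2) (pos 2) two≢0 two≢0) (product (pos 9) (pos 9) nine≢0 nine≢0)
    where
    product : ∀ i j → ι i ≢ 0# → ι j ≢ 0# → ι (i ℤ.* j) ≢ 0#
    product i j i≢0 j≢0 = *-nonzero i≢0 j≢0 ∘ trans (sym (ι-* i j))
    two≢0 : ι (pos 2) ≢ 0#
    two≢0 = ι-prime≢0 prime[2] (p≢2 ∘ sym ∘ prime-divides-power k prime[2] p-prime)
    prime[3] : Prime 3
    prime[3] = from-yes (prime? 3)
    three≢0 : ι (pos 3) ≢ 0#
    three≢0 = ι-prime≢0 prime[3] (p≢3 ∘ sym ∘ prime-divides-power k prime[3] p-prime)
    nine≢0 : ι (pos 9) ≢ 0#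
    nine≢0 = product (pos 3) (pos 3) three≢0 three≢0

-- Rules out the graph without vertices, on which every matrix acts as the identity and would have
-- to be scalar.
shear-not-Scalar : ∀ {q} (F : FiniteField q) → let open FiniteField F in ¬ Scalar F (mat 1F 1F 0F 1F)
shear-not-Scalar F (1≡0 , _) = FieldFacts.1≢0 F 1≡0

shear-GL : ∀ {q} (F : FiniteField q) → let open FiniteField F in InGL F (mat 1F 1F 0F 1F)
shear-GL F det≡0 = 1≢0 (trans (solve 1 (λ x → x := x :- x :* con 0ℤ) refl 1#)
  (trans (cong (λ x → x + - (1# * 0#)) (sym (*-identityˡ 1#))) det≡0))
  where open FieldFacts F

≡3-excluded : ∀ {p} → (p % 5 ≡ 0) ⊎ (p % 5 ≡ 1) ⊎ (p % 5 ≡ 4) → p ≢ 3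
≡3-excluded (inj₁ ())        refl
≡3-excluded (inj₂ (inj₁ ())) refl
≡3-excluded (inj₂ (inj₂ ())) refl

theorem7p1 : (p k : ℕ) → Prime p → p ≢ 2 → 1 ≤ k →
    (F : FiniteField (p ^ k)) →
    (n : ℕ) (X : Graph n) → Connected X → Cubic X → ArcTransitive X → TypeOne2¹ X →
    (ψ : M2 (p ^ k) → (Fin n → Fin n)) →
    (∀ A B → InGL F A → InGL F B → ψ (_·M_ F A B) ≗ (ψ A ∘ ψ B)) →
    (∀ A → InGL F A → IsAut X (ψ A)) →
    (∀ f → IsAut X f → ∃[ A ] (InGL F A × f ≗ ψ A)) →
    (∀ A → InGL F A → (ψ A ≗ id → Scalar F A) × (Scalar F A → ψ A ≗ id)) →
    RegularOnArcs X (λ f → ∃[ A ] (InSL F A × f ≗ ψ A)) →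
    (p % 5 ≡ 0) ⊎ (p % 5 ≡ 1) ⊎ (p % 5 ≡ 4) →
    IntersectionDensityOne (IsAut X)
theorem7p1 p k p-prime p≢2 _ F zero X _ _ _ _ ψ _ _ _ ψ-kernel _ _ =
  contradiction (proj₁ (ψ-kernel _ (shear-GL F)) λ ()) (shear-not-Scalar F)
theorem7p1 p k p-prime p≢2 _ F (suc n) X _ cubic _ (regular , _) ψ ψ-∘ ψ-aut ψ-onto ψ-kernel special-regular p%5 =
  density-one (intersecting-bound)
  where
  open CubicGraph.Counting X cubic regular zero using (density-one)
  open IntersectingFamilies F (ι-N≢0 p k p-prime p≢2 (≡3-excluded p%5) F) X cubic regular
    ψ ψ-∘ ψ-aut ψ-onto ψ-kernel special-regular zero using (intersecting-bound)
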